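{- Let $q\ge 2$ be an integer. For positive integers $m,n$, the number of $q$-ary (strong) lonesum $m\times n$ matrices equals $$1+\sum_{j=1}^{\min(m,n)}\ \sum_{\substack{(m_0,m_1,\ldots,m_j)\in\mathcal{S}_m^j\\ (n_0,n_1,\ldots,n_j)\in\mathcal{S}_n^j}} \binom{m}{m_0,m_1,\ldots,m_j}\binom{n}{n_0,n_1,\ldots,n_j}\prod_{i=1}^{j} f_q(m_i,n_{j+1-i}),$$ where $f_q(r,s)=1+(q-2)rs+r\big((q-1)^s-(q-2)s-1\big)+s\big((q-1)^r-(q-2)r-1\big)$.
   Context: A $q$-ary matrix has entries in $\{0,1,\ldots,q-1\}$. A $q$-ary $m\times n$ matrix $M$ is a (strong) lonesum matrix if it is the only $q$-ary $m\times n$ matrix with the same row sums and the same column sums as $M$. For integers $j\ge 1$, $l\ge 1$, $\mathcal{S}_l^j=\{(l_0,l_1,\ldots,l_j)\in\mathbb{Z}^{j+1} : \sum_{i=0}^j l_i=l,\ l_0\ge 0,\ l_i\ge 1 \text{ for } 1\le i\le j\}$. $\binom{m}{m_0,\ldots,m_j}$ denotes the multinomial coefficient. -}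

module Defs where

open import Data.Nat using (ℕ; zero; suc; _+_; _*_; _∸_; _^_; _≤_; _⊓_)
open import Data.Nat.Properties using (_≟_; _≤?_)
open import Data.Nat.Combinatorics using (_C_)
open import Data.Fin using (Fin; toℕ; opposite) renaming (suc to fs)
open import Data.Vec as V using (Vec; []; _∷_; lookup)
open import Data.Vec.Relation.Unary.All using (All; all?)
open import Data.List as L using (List; upTo; map; concatMap; filter)
open import Data.Nat.ListAction using (sum; product)
open import Data.Product using (_×_)
open import Relation.Nullary.Decidable using (_×-dec_)
open import Relation.Binary.PropositionalEquality using (_≡_)

Matrix : ℕ → ℕ → ℕ → Set
Matrix q m n = Vec (Vec (Fin q) n) m

rowSums : ∀ {q m n} → Matrix q m n → Vec ℕ m
rowSums = V.map (λ r → V.sum (V.map toℕ r))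

colSums : ∀ {q m n} → Matrix q m n → Vec ℕ n
colSums M = V.tabulate (λ j → V.sum (V.map (λ r → toℕ (lookup r j)) M))

IsLonesum : ∀ {q m n} → Matrix q m n → Set
IsLonesum {q} {m} {n} M =
  (N : Matrix q m n) → rowSums N ≡ rowSums M → colSums N ≡ colSums M → N ≡ M

vecsUpTo : ℕ → (k : ℕ) → List (Vec ℕ k)
vecsUpTo b zero = [] L.∷ L.[]
vecsUpTo b (suc k) = concatMap (λ x → map (x ∷_) (vecsUpTo b k)) (upTo (suc b))

InS : (l j : ℕ) → Vec ℕ (suc j) → Set
InS l j v = (V.sum v ≡ l) × All (1 ≤_) (V.tail v)

-- S_l^j as an explicit list (entries are all ≤ l, so this is complete)
S : (l j : ℕ) → List (Vec ℕ (suc j))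
S l j = filter (λ v → (V.sum v ≟ l) ×-dec all? (1 ≤?_) (V.tail v)) (vecsUpTo l (suc j))

multinomial : ∀ {k} → Vec ℕ k → ℕ
multinomial [] = 1
multinomial (x ∷ xs) = ((x + V.sum xs) C x) * multinomial xs

fq : ℕ → ℕ → ℕ → ℕ
fq q r s = 1 + (q ∸ 2) * r * s
             + r * (((q ∸ 1) ^ s ∸ (q ∸ 2) * s) ∸ 1)
             + s * (((q ∸ 1) ^ r ∸ (q ∸ 2) * r) ∸ 1)

-- ∏_{i=1}^{j} f_q(m_i, n_{j+1-i}); index i = 1 + i' with i' : Fin j, and
-- j+1-i = 1 + opposite i'
prodF : ℕ → (j : ℕ) → Vec ℕ (suc j) → Vec ℕ (suc j) → ℕ
prodF q j mv nv =
  product (L.map (λ (i : Fin j) → fq q (lookup mv (fs i)) (lookup nv (fs (opposite i)))) (L.allFin j))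

lonesumCount : ℕ → ℕ → ℕ → ℕ
lonesumCount q m n =
  1 + sum (map (λ j → sum (concatMap (λ mv →
          map (λ nv → multinomial mv * multinomial nv * prodF q j mv nv) (S n j))
        (S m j)))
      (map suc (upTo (m ⊓ n))))

{-# OPTIONS --safe #-}
module Submission where

-- A matrix is lonesum iff it is unswitchable: there are no rows i ≠ i′ and
-- columns j ≠ j′ such that the entries (i,j), (i′,j′) are less than q - 1 while
-- (i,j′), (i′,j) are positive.  The row supports of such a matrix form a chain.
-- Discard the zero rows and columns, let R₁ be the set of full rows and K₁ that
-- of the columns supported on R₁ only.  Both are nonempty, the entries in R₁
-- outside K₁ are all q - 1, and those in K₁ outside R₁ are zero.  On R₁ × K₁ all
-- entries are positive and the ones below q - 1 share a row or a column, which
-- leaves f_q(|R₁|,|K₁|) possibilities.  Removing R₁ and K₁ leaves an arbitrary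
-- unswitchable matrix without zero rows and columns, so the count satisfies a
-- binomial recursion whose j-th iterate is the j-th summand.  The first peel
-- takes m₁ rows and n_j columns, the order in which the column parts are taken
-- being irrelevant by the symmetry of the multinomial coefficient.

open import Defs
import Algebra.Properties.CommutativeSemigroup as CommutativeSemigroup
open import Data.Bool using (Bool; true; false; not; _∧_; if_then_else_)
import Data.Bool.Properties as Bool
open import Data.Empty using (⊥; ⊥-elim)
open import Data.Fin using (Fin; zero; suc; toℕ; fromℕ; inject₁; opposite)
import Data.Fin.Properties as Fin
open import Data.List using (List; []; _∷_; _++_; map; concatMap; length; filter; upTo; applyUpTo; allFin; tabulate)
import Data.List.Properties as List
open import Data.List.Membership.Propositional using (_∈_)
open import Data.List.Membership.Propositional.Properties
  using (∈-map⁺; ∈-map⁻; ∈-++⁺ˡ; ∈-++⁺ʳ; ∈-++⁻; ∈-allFin)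
open import Data.List.Relation.Unary.All using (All; []; _∷_)
import Data.List.Relation.Unary.All as All
import Data.List.Relation.Unary.All.Properties as All
open import Data.List.Relation.Unary.Any using (here; there)
open import Data.List.Relation.Unary.AllPairs using ([]; _∷_)
open import Data.List.Relation.Unary.Unique.Propositional using (Unique)
import Data.List.Relation.Unary.Unique.Propositional.Properties as Unique
open import Data.Nat using (ℕ; zero; suc; _+_; _*_; _∸_; _^_; _≤_; _<_; _⊓_; z≤n; s≤s; s≤s⁻¹)
open import Data.Nat.Combinatorics using (_C_; nCk+nC[k+1]≡[n+1]C[k+1]; k>n⇒nCk≡0)
open import Data.Nat.ListAction using (sum; product)
open import Data.Nat.ListAction.Properties using (sum-++)
import Data.Nat.Properties as ℕ
open import Data.Nat.Solver using (module +-*-Solver)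
open import Data.Product using (Σ; ∃; ∃₂; _×_; _,_; proj₁; proj₂)
open import Data.Sum using (_⊎_; inj₁; inj₂; [_,_]′)
open import Data.Unit using (⊤; tt)
open import Data.Vec using (Vec; []; _∷_; _∷ʳ_; lookup; head; tail)
import Data.Vec as Vec
import Data.Vec.Properties as Vec
import Data.Vec.Relation.Unary.All as VAll
open import Function using (_∘_; id; const)
open import Function.Bundles using (_⇔_; mk⇔)
open import Relation.Binary.PropositionalEquality
  using (_≡_; _≢_; refl; sym; trans; cong; cong₂; subst; module ≡-Reasoning)
open import Relation.Nullary using (¬_; Dec; yes; no; does; contradiction)
open import Relation.Nullary.Decidable using (_×-dec_; ¬?)
open import Relation.Unary using (Decidable)

-- Being lonesum refers to every other matrix, unswitchability to four entries only. Moving one unit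
-- around a rectangle preserves all sums; conversely, a rival matrix with the same sums yields an
-- endless alternating walk through entries where it is smaller or larger. By finiteness this walk
-- repeats a column, and unswitchability forbids just that. No submatrix is ever formed. Sets of
-- rows and columns are Boolean vectors, and every matrix keeps its size m × n, being zero
-- elsewhere, so that gluing and peeling need no reindexing. Accordingly, binomial coefficients
-- appear as multiplicities: the splittings of a selected set match the list `bipartitions` of its
-- size, and Pascal's rule is used once, to translate the formula. Every peel takes at least one row
-- and one column, which bounds the number j of peels by min(m, n).

private variable
  A B : Set
  n : ℕ

-- Enumerations and cardinalities of predicates

record Enum {A : Set} (P : A → Set) (L : List A) : Set where
  field
    unique   : Unique L
    sound    : ∀ {x} → x ∈ L → P x
    complete : ∀ {x} → P x → x ∈ L
open Enum

record Card {A : Set} (P : A → Set) (k : ℕ) : Set where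
  constructor card
  field
    {elements} : List A
    enum : Enum P elements
    size : length elements ≡ k
open Card

unique-map : ∀ {f : A → B} {L} →
  (∀ {x y} → x ∈ L → y ∈ L → f x ≡ f y → x ≡ y) → Unique L → Unique (map f L)
unique-map {L = []} inj [] = []
unique-map {L = x ∷ L} inj (px ∷ u) =
  All.map⁺ (All.tabulate λ y∈L fx≡fy →
    All.lookup px y∈L (inj (here refl) (there y∈L) fx≡fy))
  ∷ unique-map (λ a b → inj (there a) (there b)) u

enum-cong : ∀ {P Q : A → Set} {L} → (∀ {x} → P x → Q x) → (∀ {x} → Q x → P x) →
  Enum P L → Enum Q L
enum-cong P⇒Q Q⇒P e = record
  { unique = unique e ; sound = P⇒Q ∘ sound e ; complete = complete e ∘ Q⇒P }

enum-image : ∀ {P : A → Set} {L} (f : A → B) →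
  (∀ {x y} → P x → P y → f x ≡ f y → x ≡ y) →
  Enum P L → Enum (λ y → ∃ λ x → P x × y ≡ f x) (map f L)
enum-image f inj e = record
  { unique   = unique-map (λ x∈ y∈ → inj (sound e x∈) (sound e y∈)) (unique e)
  ; sound    = λ y∈ → let x , x∈ , eq = ∈-map⁻ f y∈ in x , sound e x∈ , eq
  ; complete = λ { (x , px , refl) → ∈-map⁺ f (complete e px) }
  }

enum-⊎ : ∀ {P Q : A → Set} {L L′} → (∀ {x} → P x → Q x → ⊥) →
  Enum P L → Enum Q L′ → Enum (λ x → P x ⊎ Q x) (L ++ L′)
enum-⊎ {L = L} disj e e′ = record
  { unique   = Unique.++⁺ (unique e) (unique e′) λ (a , b) → disj (sound e a) (sound e′ b)
  ; sound    = λ x∈ → [ inj₁ ∘ sound e , inj₂ ∘ sound e′ ]′ (∈-++⁻ L x∈)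
  ; complete = [ ∈-++⁺ˡ ∘ complete e , ∈-++⁺ʳ L ∘ complete e′ ]′
  }

enum-single : (x : A) → Enum (_≡ x) (x ∷ [])
enum-single x = record
  { unique = [] ∷ [] ; sound = λ { (here eq) → eq } ; complete = here }

enum-empty : ∀ {P : A → Set} → (∀ {x} → ¬ P x) → Enum P []
enum-empty ¬P = record
  { unique = [] ; sound = λ () ; complete = λ px → ⊥-elim (¬P px) }

card-cong : ∀ {P Q : A → Set} {k} → (∀ {x} → P x → Q x) → (∀ {x} → Q x → P x) →
  Card P k → Card Q k
card-cong P⇒Q Q⇒P (card e s) = card (enum-cong P⇒Q Q⇒P e) s

card-image : ∀ {P : A → Set} {k} (f : A → B) →
  (∀ {x y} → P x → P y → f x ≡ f y → x ≡ y) →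
  Card P k → Card (λ y → ∃ λ x → P x × y ≡ f x) k
card-image f inj c@(card e s) = card (enum-image f inj e) (trans (List.length-map f (elements c)) s)

card-⊎ : ∀ {P Q : A → Set} {k l} → (∀ {x} → P x → Q x → ⊥) →
  Card P k → Card Q l → Card (λ x → P x ⊎ Q x) (k + l)
card-⊎ disj (card {L} e s) (card e′ s′) =
  card (enum-⊎ disj e e′) (trans (List.length-++ L) (cong₂ _+_ s s′))

card-single : (x : A) → Card (_≡ x) 1
card-single x = card (enum-single x) refl

card-empty : ∀ {P : A → Set} → (∀ {x} → ¬ P x) → Card P 0
card-empty ¬P = card (enum-empty ¬P) refl

∑ : List A → (A → ℕ) → ℕ
∑ L f = sum (map f L)

-- The size of the fibre varies with `a`, so the total is a sum over a given enumeration `L` instead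
-- of a product; sums over `splits` arise in this way.
card-Σ : ∀ {P : A → Set} {Q : A → B → Set} {L k} → Enum P L →
  (∀ a → P a → Card (Q a) (k a)) → Card {A × B} (λ (a , b) → P a × Q a b) (∑ L k)
card-Σ {A = A} {B} {P} {Q} {L} {k} e cQ =
  card-cong {P = λ (a , b) → a ∈ L × Q a b}
    (λ (a∈ , q) → sound e a∈ , q) (λ (p , q) → complete e p , q)
    (go L (unique e) (λ a a∈ → cQ a (sound e a∈)))
  where
  go : ∀ L → Unique L → (∀ a → a ∈ L → Card (Q a) (k a)) →
       Card {A × B} (λ (a , b) → a ∈ L × Q a b) (∑ L k)
  go [] [] c = card-empty {P = λ (a , b) → a ∈ [] × Q a b} λ { (() , _) }
  go (x ∷ L) (x∉ ∷ u) c =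
    card-cong
      (λ { {_ , _} (inj₁ (b , q , refl)) → here refl , q ; (inj₂ (a∈ , q)) → there a∈ , q })
      (λ { {_ , b} (here refl , q) → inj₁ (b , q , refl) ; (there a∈ , q) → inj₂ (a∈ , q) })
      (card-⊎ (λ { {_ , _} (b , q , refl) (x∈ , _) → All.lookup x∉ x∈ refl })
        (card-image (x ,_) (λ { _ _ refl → refl }) (c x (here refl)))
        (go L u λ a a∈ → c a (there a∈)))

∑-const : ∀ (L : List A) k → ∑ L (const k) ≡ length L * k
∑-const [] k = refl
∑-const (x ∷ L) k = cong (k +_) (∑-const L k)

-- Only the sizes of the fibres have to agree: in a block, for instance, the columns open to the
-- remaining rows depend on the first row.
card-× : ∀ {P : A → Set} {Q : A → B → Set} {k l} → Card P k →
  (∀ {a} → P a → Card (Q a) l) → Card {A × B} (λ (a , b) → P a × Q a b) (k * l)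
card-× {l = l} (card {L} e s) c =
  subst (Card _) (trans (∑-const L l) (cong (_* l) s)) (card-Σ {k = const l} e λ a p → c p)

card-∷ : ∀ {P : A → Vec A n → Set} {k} → Card {A × Vec A n} (λ (a , v) → P a v) k →
  Card (λ v → P (head v) (tail v)) k
card-∷ c =
  card-cong (λ { ((a , v) , p , refl) → p }) (λ { {a ∷ v} p → (a , v) , p , refl })
    (card-image (λ (a , v) → a ∷ v) (λ { _ _ refl → refl }) c)

count : Vec Bool n → ℕ
count [] = 0
count (true ∷ b) = suc (count b)
count (false ∷ b) = count b

-- Serves both for rows as vectors of entries and for matrices as vectors of rows: a marked position
-- has `t` choices, any other is forced.
card-lookup : ∀ (b : Vec Bool n) {t} {P : Fin n → A → Set} →
  (∀ i → Card (P i) (if lookup b i then t else 1)) →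
  Card (λ v → ∀ i → P i (lookup v i)) (t ^ count b)
card-lookup [] c = card-cong (λ _ ()) (λ { {[]} _ → refl }) (card-single [])
card-lookup (b ∷ bs) {t} {P} c =
  card-cong {P = λ v → P zero (head v) × (∀ i → P (suc i) (lookup (tail v) i))}
    (λ { {a ∷ v} (p , q) zero → p ; {a ∷ v} (p , q) (suc i) → q i })
    (λ { {a ∷ v} p → p zero , λ i → p (suc i) })
    (subst (Card _) (eq b) (card-∷ {P = λ a v → P zero a × (∀ i → P (suc i) (lookup v i))} (card-× (c zero) λ _ → card-lookup bs {t} {P ∘ suc} (c ∘ suc))))
  where
  eq : ∀ b → (if b then t else 1) * t ^ count bs ≡ t ^ (count (b ∷ bs))
  eq true = refl
  eq false = ℕ.+-identityʳ _

-- Finite sums and binomial convolution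

∑-++ : ∀ (L L′ : List A) (f : A → ℕ) → ∑ (L ++ L′) f ≡ ∑ L f + ∑ L′ f
∑-++ L L′ f = trans (cong sum (List.map-++ f L L′)) (sum-++ (map f L) (map f L′))

∑-map : ∀ (g : A → B) L (f : B → ℕ) → ∑ (map g L) f ≡ ∑ L (f ∘ g)
∑-map g L f = cong sum (sym (List.map-∘ L))

∑-cong : ∀ (L : List A) {f g : A → ℕ} → (∀ x → f x ≡ g x) → ∑ L f ≡ ∑ L g
∑-cong L eq = cong sum (List.map-cong eq L)

∑-concatMap : ∀ (g : A → List B) L (f : B → ℕ) →
  ∑ (concatMap g L) f ≡ ∑ L (λ x → ∑ (g x) f)
∑-concatMap g [] f = refl
∑-concatMap g (x ∷ L) f =
  trans (∑-++ (g x) (concatMap g L) f) (cong (∑ (g x) f +_) (∑-concatMap g L f))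

private
  module + = CommutativeSemigroup ℕ.+-commutativeSemigroup
  module * = CommutativeSemigroup ℕ.*-commutativeSemigroup

∑-+ : ∀ (L : List A) (f g : A → ℕ) → ∑ L (λ x → f x + g x) ≡ ∑ L f + ∑ L g
∑-+ [] f g = refl
∑-+ (x ∷ L) f g = trans (cong ((f x + g x) +_) (∑-+ L f g)) (+.interchange (f x) (g x) _ _)

∑-* : ∀ (L : List A) k (f : A → ℕ) → ∑ L (λ x → k * f x) ≡ k * ∑ L f
∑-* [] k f = sym (ℕ.*-zeroʳ k)
∑-* (x ∷ L) k f = trans (cong (k * f x +_) (∑-* L k f)) (sym (ℕ.*-distribˡ-+ k (f x) _))

∑-zero : ∀ (L : List A) → ∑ L (const 0) ≡ 0
∑-zero L = trans (∑-const L 0) (ℕ.*-zeroʳ (length L))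

∑-comm : ∀ (L : List A) (L′ : List B) (f : A → B → ℕ) →
  ∑ L (λ x → ∑ L′ (f x)) ≡ ∑ L′ (λ y → ∑ L (λ x → f x y))
∑-comm [] L′ f = sym (∑-zero L′)
∑-comm (x ∷ L) L′ f =
  trans (cong (∑ L′ (f x) +_) (∑-comm L L′ f)) (sym (∑-+ L′ (f x) _))

∑-upTo-suc : ∀ b (f : ℕ → ℕ) → ∑ (upTo (suc b)) f ≡ f 0 + ∑ (upTo b) (f ∘ suc)
∑-upTo-suc b f = cong (f 0 +_) (cong sum (begin
  map f (applyUpTo suc b)      ≡⟨ List.map-applyUpTo suc f b ⟩
  applyUpTo (f ∘ suc) b        ≡⟨ List.map-applyUpTo id (f ∘ suc) b ⟨
  map (f ∘ suc) (upTo b)       ∎))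
  where open ≡-Reasoning

-- Each pair (k , l - k) occurs C(l,k) times: once for each subset of an l-set.
bipartitions : ℕ → List (ℕ × ℕ)
bipartitions zero = (0 , 0) ∷ []
bipartitions (suc l) =
  map (λ (a , r) → suc a , r) (bipartitions l) ++ map (λ (a , r) → a , suc r) (bipartitions l)

∑₂ : ℕ → (ℕ → ℕ → ℕ) → ℕ
∑₂ l h = ∑ (bipartitions l) (λ (a , r) → h a r)

∑₂-cong : ∀ l {h h′ : ℕ → ℕ → ℕ} → (∀ a r → h a r ≡ h′ a r) → ∑₂ l h ≡ ∑₂ l h′
∑₂-cong l eq = ∑-cong (bipartitions l) λ (a , r) → eq a r

∑₂-suc : ∀ l (h : ℕ → ℕ → ℕ) →
  ∑₂ (suc l) h ≡ ∑₂ l (λ a r → h (suc a) r) + ∑₂ l (λ a r → h a (suc r))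
∑₂-suc l h = trans (∑-++ (map _ (bipartitions l)) _ _)
  (cong₂ _+_ (∑-map _ (bipartitions l) _) (∑-map _ (bipartitions l) _))

∑₂-+ : ∀ l (h h′ : ℕ → ℕ → ℕ) → ∑₂ l (λ a r → h a r + h′ a r) ≡ ∑₂ l h + ∑₂ l h′
∑₂-+ l h h′ = ∑-+ (bipartitions l) _ _

-- Both sides sum over the ordered partitions of an l-set into three parts.
∑₂-exchange : ∀ l (h : ℕ → ℕ → ℕ → ℕ) →
  ∑₂ l (λ a r → ∑₂ r (λ b s → h a b s)) ≡ ∑₂ l (λ b r → ∑₂ r (λ a s → h a b s))
∑₂-exchange zero h = refl
∑₂-exchange (suc l) h = begin
  ∑₂ (suc l) (λ a r → ∑₂ r (λ b s → h a b s))
    ≡⟨ ∑₂-suc l _ ⟩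
  ∑₂ l (λ a r → ∑₂ r (λ b s → h (suc a) b s)) + ∑₂ l (λ a r → ∑₂ (suc r) (λ b s → h a b s))
    ≡⟨ cong₂ _+_ (∑₂-exchange l (h ∘ suc)) (expand h) ⟩
  X + (∑₂ l (λ a r → ∑₂ r (λ b s → h a (suc b) s)) + ∑₂ l (λ a r → ∑₂ r (λ b s → h a b (suc s))))
    ≡⟨ cong (X +_) (cong₂ _+_ (∑₂-exchange l (λ a b → h a (suc b)))
         (∑₂-exchange l (λ a b s → h a b (suc s)))) ⟩
  X + (Y + Z)
    ≡⟨ +.x∙yz≈y∙xz X Y Z ⟩
  Y + (X + Z)
    ≡⟨ cong (Y +_) (expand (λ b a → h a b)) ⟨
  Y + ∑₂ l (λ b r → ∑₂ (suc r) (λ a s → h a b s))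
    ≡⟨ ∑₂-suc l (λ b r → ∑₂ r (λ a s → h a b s)) ⟨
  ∑₂ (suc l) (λ b r → ∑₂ r (λ a s → h a b s)) ∎
  where
  open ≡-Reasoning
  X Y Z : ℕ
  X = ∑₂ l (λ b r → ∑₂ r (λ a s → h (suc a) b s))
  Y = ∑₂ l (λ b r → ∑₂ r (λ a s → h a (suc b) s))
  Z = ∑₂ l (λ b r → ∑₂ r (λ a s → h a b (suc s)))
  expand : ∀ (h : ℕ → ℕ → ℕ → ℕ) →
    ∑₂ l (λ a r → ∑₂ (suc r) (h a)) ≡
    ∑₂ l (λ a r → ∑₂ r (λ b s → h a (suc b) s)) + ∑₂ l (λ a r → ∑₂ r (λ b s → h a b (suc s)))
  expand h = trans (∑₂-cong l λ a r → ∑₂-suc r (h a)) (∑₂-+ l _ _)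

-- Pascal's rule, by induction on `l`. The range may exceed `l`, where the coefficients vanish; this
-- slack is needed since `vecsUpTo` keeps one bound for all components while the remaining total
-- shrinks.
∑-binomial : ∀ b l → l ≤ b → ∀ (h : ℕ → ℕ → ℕ) →
  ∑ (upTo (suc b)) (λ x → (l C x) * h x (l ∸ x)) ≡ ∑₂ l h
∑-binomial b zero _ h = begin
  ∑ (upTo (suc b)) (λ x → (0 C x) * h x (0 ∸ x))
    ≡⟨ ∑-upTo-suc b _ ⟩
  (0 C 0) * h 0 0 + ∑ (upTo b) (λ x → (0 C suc x) * h (suc x) 0)
    ≡⟨ cong₂ _+_ (ℕ.*-identityˡ (h 0 0))
         (trans (∑-cong (upTo b) λ x → cong (_* h (suc x) 0) (k>n⇒nCk≡0 (s≤s (z≤n {x}))))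
           (∑-zero (upTo b))) ⟩
  h 0 0 + 0 ∎
  where open ≡-Reasoning
∑-binomial (suc b) (suc l) (s≤s l≤b) h = begin
  ∑ (upTo (suc (suc b))) t
    ≡⟨ ∑-upTo-suc (suc b) t ⟩
  t 0 + ∑ (upTo (suc b)) (t ∘ suc)
    ≡⟨ cong (t 0 +_) (trans (∑-cong (upTo (suc b)) pascal) (∑-+ (upTo (suc b)) f g)) ⟩
  t 0 + (∑ (upTo (suc b)) f + ∑ (upTo (suc b)) g)
    ≡⟨ +.x∙yz≈y∙xz (t 0) (∑ (upTo (suc b)) f) (∑ (upTo (suc b)) g) ⟩
  ∑ (upTo (suc b)) f + (t 0 + ∑ (upTo (suc b)) g)
    ≡⟨ cong₂ _+_ (∑-binomial b l l≤b (h ∘ suc))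
         (trans (cong (t 0 +_) (∑-cong (upTo (suc b)) shift)) (sym (∑-upTo-suc (suc b) t′))) ⟩
  ∑₂ l (h ∘ suc) + ∑ (upTo (suc (suc b))) t′
    ≡⟨ cong (∑₂ l (h ∘ suc) +_) (∑-binomial (suc b) l (ℕ.m≤n⇒m≤1+n l≤b) (λ k r → h k (suc r))) ⟩
  ∑₂ l (h ∘ suc) + ∑₂ l (λ k r → h k (suc r))
    ≡⟨ ∑₂-suc l h ⟨
  ∑₂ (suc l) h ∎
  where
  open ≡-Reasoning
  t t′ f g : ℕ → ℕ
  t x = (suc l C x) * h x (suc l ∸ x)
  t′ x = (l C x) * h x (suc (l ∸ x))
  f x = (l C x) * h (suc x) (l ∸ x)
  g x = (l C suc x) * h (suc x) (l ∸ x)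
  pascal : ∀ x → (suc l C suc x) * h (suc x) (l ∸ x) ≡
    (l C x) * h (suc x) (l ∸ x) + (l C suc x) * h (suc x) (l ∸ x)
  pascal x = trans (cong (_* h (suc x) (l ∸ x)) (sym (nCk+nC[k+1]≡[n+1]C[k+1] l x)))
    (ℕ.*-distribʳ-+ (h (suc x) (l ∸ x)) (l C x) (l C suc x))
  -- The two truncated differences disagree only for x ≥ l, where the binomial coefficient is zero.
  shift : ∀ x → (l C suc x) * h (suc x) (l ∸ x) ≡ (l C suc x) * h (suc x) (suc (l ∸ suc x))
  shift x with suc x ℕ.≤? l
  ... | yes x<l = cong (λ r → (l C suc x) * h (suc x) r) (ℕ.+-∸-assoc 1 x<l)
  ... | no x≮l rewrite k>n⇒nCk≡0 (ℕ.≰⇒> x≮l) = refl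

-- Compositions

isZero isPos : ℕ → ℕ
isZero zero = 1
isZero (suc _) = 0
isPos zero = 0
isPos (suc _) = 1

-- Sums over compositions of `l` into `j` parts, weak or positive, each weighted by its multinomial
-- coefficient: the weight is hidden in the multiplicities of `∑₂`, and the final `isZero` forces
-- the parts to add up to `l`.
weakSum posSum : ∀ j → ℕ → (Vec ℕ j → ℕ) → ℕ
weakSum zero l F = isZero l * F []
weakSum (suc j) l F = ∑₂ l (λ a r → weakSum j r (F ∘ (a ∷_)))
posSum zero l F = isZero l * F []
posSum (suc j) l F = ∑₂ l (λ a r → isPos a * posSum j r (F ∘ (a ∷_)))

posSum-cong : ∀ j l {F G : Vec ℕ j → ℕ} → (∀ v → F v ≡ G v) → posSum j l F ≡ posSum j l G
posSum-cong zero l eq = cong (isZero l *_) (eq [])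
posSum-cong (suc j) l eq = ∑₂-cong l λ a r → cong (isPos a *_) (posSum-cong j r (eq ∘ (a ∷_)))

posSum-∑ : ∀ j l (L : List A) (F : Vec ℕ j → A → ℕ) →
  posSum j l (λ u → ∑ L (F u)) ≡ ∑ L (λ x → posSum j l (λ u → F u x))
posSum-∑ zero l L F = sym (∑-* L (isZero l) (F []))
posSum-∑ (suc j) l L F =
  trans (∑₂-cong l λ a r → trans (cong (isPos a *_) (posSum-∑ j r L (F ∘ (a ∷_)))) (sym (∑-* L (isPos a) _)))
    (∑-comm (bipartitions l) L _)

posSum-* : ∀ j l k (F : Vec ℕ j → ℕ) → posSum j l (λ u → k * F u) ≡ k * posSum j l F
posSum-* zero l k F = *.x∙yz≈y∙xz (isZero l) k (F [])
posSum-* (suc j) l k F =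
  trans (∑₂-cong l λ a r → trans (cong (isPos a *_) (posSum-* j r k (F ∘ (a ∷_)))) (*.x∙yz≈y∙xz (isPos a) k _))
    (∑-* (bipartitions l) k _)

-- The part split off first may just as well be the last one, by `∑₂-exchange`. This accounts for
-- the reversed index in the formula, since a peel contributes the first row part and the last
-- column part.
posSum-snoc : ∀ j l (F : Vec ℕ (suc j) → ℕ) →
  posSum (suc j) l F ≡ ∑₂ l (λ a r → isPos a * posSum j r (λ v → F (v ∷ʳ a)))
posSum-snoc zero l F = refl
posSum-snoc (suc j) l F = begin
  ∑₂ l (λ a r → isPos a * posSum (suc j) r (F ∘ (a ∷_)))
    ≡⟨ ∑₂-cong l (λ a r → trans (cong (isPos a *_) (posSum-snoc j r (F ∘ (a ∷_))))
         (sym (∑-* (bipartitions r) (isPos a) _))) ⟩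
  ∑₂ l (λ a r → ∑₂ r (λ b s → isPos a * (isPos b * posSum j s (λ v → F (a ∷ (v ∷ʳ b))))))
    ≡⟨ ∑₂-exchange l _ ⟩
  ∑₂ l (λ b r → ∑₂ r (λ a s → isPos a * (isPos b * posSum j s (λ v → F (a ∷ (v ∷ʳ b))))))
    ≡⟨ ∑₂-cong l (λ b r → trans (∑₂-cong r (λ a s → *.x∙yz≈y∙xz (isPos a) (isPos b) _))
         (∑-* (bipartitions r) (isPos b) _)) ⟩
  ∑₂ l (λ b r → isPos b * posSum (suc j) r (λ v → F (v ∷ʳ b))) ∎
  where open ≡-Reasoning

allPos : ∀ {k} → Vec ℕ k → ℕ
allPos [] = 1
allPos (x ∷ v) = isPos x * allPos v

posSum≡weakSum : ∀ j l (F : Vec ℕ j → ℕ) → posSum j l F ≡ weakSum j l (λ v → allPos v * F v)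
posSum≡weakSum zero l F = cong (isZero l *_) (sym (ℕ.+-identityʳ (F [])))
posSum≡weakSum (suc j) l F = ∑₂-cong l λ a r → begin
  isPos a * posSum j r (F ∘ (a ∷_))
    ≡⟨ posSum-* j r (isPos a) _ ⟨
  posSum j r (λ v → isPos a * F (a ∷ v))
    ≡⟨ posSum≡weakSum j r _ ⟩
  weakSum j r (λ v → allPos v * (isPos a * F (a ∷ v)))
    ≡⟨ weakSum-cong j r (λ v → trans (*.x∙yz≈y∙xz (allPos v) (isPos a) _) (sym (ℕ.*-assoc (isPos a) _ _))) ⟩
  weakSum j r (λ v → (isPos a * allPos v) * F (a ∷ v)) ∎
  where
  open ≡-Reasoning
  weakSum-cong : ∀ j l {F G : Vec ℕ j → ℕ} → (∀ v → F v ≡ G v) → weakSum j l F ≡ weakSum j l G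
  weakSum-cong zero l eq = cong (isZero l *_) (eq [])
  weakSum-cong (suc j) l eq = ∑₂-cong l λ a r → weakSum-cong j r (eq ∘ (a ∷_))

indicator : {P : Set} → Dec P → ℕ
indicator (yes _) = 1
indicator (no _) = 0

indicator-⇔ : {P Q : Set} (d : Dec P) (d′ : Dec Q) → (P → Q) → (Q → P) → indicator d ≡ indicator d′
indicator-⇔ (yes p) (yes q) f g = refl
indicator-⇔ (yes p) (no ¬q) f g = contradiction (f p) ¬q
indicator-⇔ (no ¬p) (yes q) f g = contradiction (g q) ¬p
indicator-⇔ (no ¬p) (no ¬q) f g = refl

∑-filter : ∀ {P : A → Set} (P? : Decidable P) L (f : A → ℕ) →
  ∑ (filter P? L) f ≡ ∑ L (λ x → indicator (P? x) * f x)
∑-filter P? [] f = refl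
∑-filter P? (x ∷ L) f with P? x
... | yes _ = cong₂ _+_ (sym (ℕ.+-identityʳ (f x))) (∑-filter P? L f)
... | no _ = ∑-filter P? L f

-- Here the multiplicities of `∑₂` are identified with the explicit multinomial coefficients of the
-- formula.
weakSum-vecsUpTo : ∀ k b l → l ≤ b → (F : Vec ℕ k → ℕ) →
  ∑ (vecsUpTo b k) (λ v → indicator (Vec.sum v ℕ.≟ l) * (multinomial v * F v)) ≡ weakSum k l F
weakSum-vecsUpTo zero b zero _ F =
  trans (ℕ.+-identityʳ _) (cong (1 *_) (ℕ.*-identityˡ (F [])))
weakSum-vecsUpTo zero b (suc l) _ F = refl
weakSum-vecsUpTo (suc k) b l l≤b F = begin
  ∑ (vecsUpTo b (suc k)) T
    ≡⟨ ∑-concatMap (λ x → map (x ∷_) (vecsUpTo b k)) (upTo (suc b)) T ⟩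
  ∑ (upTo (suc b)) (λ x → ∑ (map (x ∷_) (vecsUpTo b k)) T)
    ≡⟨ ∑-cong (upTo (suc b)) inner ⟩
  ∑ (upTo (suc b)) (λ x → (l C x) * weakSum k (l ∸ x) (F ∘ (x ∷_)))
    ≡⟨ ∑-binomial b l l≤b _ ⟩
  ∑₂ l (λ a r → weakSum k r (F ∘ (a ∷_))) ∎
  where
  open ≡-Reasoning
  T : Vec ℕ (suc k) → ℕ
  T v = indicator (Vec.sum v ℕ.≟ l) * (multinomial v * F v)
  -- Where the indicator on the left is 1, the first factor of the multinomial is `l C x`. For x > l
  -- both sides vanish, on the right because `l C x` does.
  term : ∀ x v → T (x ∷ v) ≡
    (l C x) * (indicator (Vec.sum v ℕ.≟ l ∸ x) * (multinomial v * F (x ∷ v)))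
  term x v with x ℕ.≤? l
  ... | no x≰l rewrite k>n⇒nCk≡0 (ℕ.≰⇒> x≰l) with x + Vec.sum v ℕ.≟ l
  ...   | yes eq = contradiction (subst (x ≤_) eq (ℕ.m≤m+n x _)) x≰l
  ...   | no _ = refl
  term x v | yes x≤l with x + Vec.sum v ℕ.≟ l | Vec.sum v ℕ.≟ l ∸ x
  ...   | yes refl | yes _ =
    rearrange ((x + Vec.sum v) C x) (multinomial v) (F (x ∷ v))
    where
    rearrange : ∀ a b c → 1 * ((a * b) * c) ≡ a * (1 * (b * c))
    rearrange = solve 3 (λ a b c → con 1 :* ((a :* b) :* c) := a :* (con 1 :* (b :* c))) refl
      where open +-*-Solver
  ...   | yes refl | no ≢ = contradiction (sym (ℕ.m+n∸m≡n x (Vec.sum v))) ≢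
  ...   | no ≢ | yes eq = contradiction (trans (cong (x +_) eq) (ℕ.m+[n∸m]≡n x≤l)) ≢
  ...   | no _ | no _ = sym (ℕ.*-zeroʳ (l C x))
  inner : ∀ x → ∑ (map (x ∷_) (vecsUpTo b k)) T ≡ (l C x) * weakSum k (l ∸ x) (F ∘ (x ∷_))
  inner x = begin
    ∑ (map (x ∷_) (vecsUpTo b k)) T
      ≡⟨ ∑-map (x ∷_) (vecsUpTo b k) T ⟩
    ∑ (vecsUpTo b k) (T ∘ (x ∷_))
      ≡⟨ trans (∑-cong (vecsUpTo b k) (term x)) (∑-* (vecsUpTo b k) (l C x) _) ⟩
    (l C x) * ∑ (vecsUpTo b k) (λ v → indicator (Vec.sum v ℕ.≟ l ∸ x) * (multinomial v * F (x ∷ v)))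
      ≡⟨ cong ((l C x) *_) (weakSum-vecsUpTo k b (l ∸ x) (ℕ.≤-trans (ℕ.m∸n≤m l x) l≤b) (F ∘ (x ∷_))) ⟩
    (l C x) * weakSum k (l ∸ x) (F ∘ (x ∷_)) ∎

indicator-allPos : ∀ {k} (v : Vec ℕ k) → indicator (VAll.all? (1 ℕ.≤?_) v) ≡ allPos v
indicator-allPos [] = refl
indicator-allPos (zero ∷ v) =
  indicator-⇔ (VAll.all? (1 ℕ.≤?_) (zero ∷ v)) (no id) (λ { (() VAll.∷ _) }) λ ()
indicator-allPos (suc x ∷ v) =
  trans (indicator-⇔ (VAll.all? (1 ℕ.≤?_) (suc x ∷ v)) (VAll.all? (1 ℕ.≤?_) v)
           (λ { (_ VAll.∷ p) → p }) (s≤s z≤n VAll.∷_))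
    (trans (indicator-allPos v) (sym (ℕ.+-identityʳ _)))

indicator-× : {P Q : Set} (d : Dec P) (d′ : Dec Q) → indicator (d ×-dec d′) ≡ indicator d * indicator d′
indicator-× (yes _) (yes _) = refl
indicator-× (yes _) (no _) = refl
indicator-× (no _) d′ = refl

-- The zeroth component, which counts the zero rows or columns, may be zero; it is therefore split
-- off by a plain `∑₂` outside `posSum`.
∑-S : ∀ l j (F : Vec ℕ (suc j) → ℕ) →
  ∑ (S l j) (λ v → multinomial v * F v) ≡ ∑₂ l (λ a r → posSum j r (F ∘ (a ∷_)))
∑-S l j F = begin
  ∑ (S l j) (λ v → multinomial v * F v)
    ≡⟨ ∑-filter (λ v → (Vec.sum v ℕ.≟ l) ×-dec VAll.all? (1 ℕ.≤?_) (tail v)) (vecsUpTo l (suc j)) _ ⟩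
  ∑ (vecsUpTo l (suc j)) (λ v → indicator ((Vec.sum v ℕ.≟ l) ×-dec VAll.all? (1 ℕ.≤?_) (tail v)) * (multinomial v * F v))
    ≡⟨ ∑-cong (vecsUpTo l (suc j)) term ⟩
  ∑ (vecsUpTo l (suc j)) (λ v → indicator (Vec.sum v ℕ.≟ l) * (multinomial v * (allPos (tail v) * F v)))
    ≡⟨ weakSum-vecsUpTo (suc j) l l ℕ.≤-refl (λ v → allPos (tail v) * F v) ⟩
  ∑₂ l (λ a r → weakSum j r (λ v → allPos v * F (a ∷ v)))
    ≡⟨ ∑₂-cong l (λ a r → posSum≡weakSum j r (F ∘ (a ∷_))) ⟨
  ∑₂ l (λ a r → posSum j r (F ∘ (a ∷_))) ∎
  where
  open ≡-Reasoning
  rearrange : ∀ a b c d → (a * b) * (c * d) ≡ a * (c * (b * d))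
  rearrange = solve 4 (λ a b c d → (a :* b) :* (c :* d) := a :* (c :* (b :* d))) refl
    where open +-*-Solver
  term : ∀ v → indicator ((Vec.sum v ℕ.≟ l) ×-dec VAll.all? (1 ℕ.≤?_) (tail v)) * (multinomial v * F v)
    ≡ indicator (Vec.sum v ℕ.≟ l) * (multinomial v * (allPos (tail v) * F v))
  term v = trans
    (cong (_* (multinomial v * F v)) (trans (indicator-× (Vec.sum v ℕ.≟ l) _)
      (cong (indicator (Vec.sum v ℕ.≟ l) *_) (indicator-allPos (tail v)))))
    (rearrange (indicator (Vec.sum v ℕ.≟ l)) (allPos (tail v)) (multinomial v) (F v))

-- The formula as an iterated binomial convolution

-- On vectors `a ∷ u` and `b ∷ v`, `prodF` reduces to this by computation.
stair : ∀ {j} → ℕ → Vec ℕ j → Vec ℕ j → ℕ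
stair q u v = product (map (λ i → fq q (lookup u i) (lookup v (opposite i))) (allFin _))

lookup-∷ʳ-fromℕ : ∀ {n} (v : Vec A n) x → lookup (v ∷ʳ x) (fromℕ n) ≡ x
lookup-∷ʳ-fromℕ [] x = refl
lookup-∷ʳ-fromℕ (_ ∷ v) x = lookup-∷ʳ-fromℕ v x

lookup-∷ʳ-inject₁ : ∀ {n} (v : Vec A n) x i → lookup (v ∷ʳ x) (inject₁ i) ≡ lookup v i
lookup-∷ʳ-inject₁ (_ ∷ v) x zero = refl
lookup-∷ʳ-inject₁ (_ ∷ v) x (suc i) = lookup-∷ʳ-inject₁ v x i

-- `opposite` sends index zero to the last position, so the appended `b` becomes the partner of `a`
-- and all other pairs stay together.
stair-∷ : ∀ {j} q a b (u v : Vec ℕ j) → stair q (a ∷ u) (v ∷ʳ b) ≡ fq q a b * stair q u v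
stair-∷ {j} q a b u v = cong₂ _*_
  (cong (fq q a) (lookup-∷ʳ-fromℕ v b))
  (cong product (begin
    map f (tabulate suc)
      ≡⟨ List.map-tabulate suc f ⟩
    tabulate (f ∘ suc)
      ≡⟨ List.tabulate-cong (λ i → cong (fq q (lookup u i)) (lookup-∷ʳ-inject₁ v b (opposite i))) ⟩
    tabulate (λ i → fq q (lookup u i) (lookup v (opposite i)))
      ≡⟨ List.map-tabulate id _ ⟨
    map (λ i → fq q (lookup u i) (lookup v (opposite i))) (allFin j) ∎))
  where
  open ≡-Reasoning
  f : Fin (suc j) → ℕ
  f i = fq q (lookup (a ∷ u) i) (lookup (v ∷ʳ b) (opposite i))

-- `fq` equals 1 when one of the sizes is 0, so the nonemptiness of the block has to be imposed by
-- separate factors.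
properBlock : ℕ → ℕ → ℕ → ℕ
properBlock q k l = isPos k * (isPos l * fq q k l)

-- Counts the unswitchable matrices on `r` rows and `c` columns, none of them zero, that are used up
-- by exactly `j` peels.
chains : ℕ → ℕ → ℕ → ℕ → ℕ
chains q zero r c = isZero r * isZero c
chains q (suc j) r c =
  ∑₂ r λ r₁ r₂ → ∑₂ c λ c₁ c₂ → properBlock q r₁ c₁ * chains q j r₂ c₂

chains≡ : ∀ q j r c → chains q j r c ≡ posSum j r (λ u → posSum j c (λ v → stair q u v))
chains≡ q zero r c = cong (isZero r *_) (sym (ℕ.*-identityʳ (isZero c)))
chains≡ q (suc j) r c = ∑₂-cong r λ a r₂ → sym (begin
  isPos a * posSum j r₂ (λ u → posSum (suc j) c (stair q (a ∷ u)))
    ≡⟨ cong (isPos a *_) (posSum-cong j r₂ (λ u → trans (posSum-snoc j c (stair q (a ∷ u)))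
         (∑₂-cong c λ b c₂ → cong (isPos b *_)
           (trans (posSum-cong j c₂ (stair-∷ q a b u)) (posSum-* j c₂ (fq q a b) _))))) ⟩
  isPos a * posSum j r₂ (λ u → ∑₂ c (λ b c₂ → isPos b * (fq q a b * posSum j c₂ (stair q u))))
    ≡⟨ cong (isPos a *_) (posSum-∑ j r₂ (bipartitions c) _) ⟩
  isPos a * ∑₂ c (λ b c₂ → posSum j r₂ (λ u → isPos b * (fq q a b * posSum j c₂ (stair q u))))
    ≡⟨ ∑-* (bipartitions c) (isPos a) _ ⟨
  ∑₂ c (λ b c₂ → isPos a * posSum j r₂ (λ u → isPos b * (fq q a b * posSum j c₂ (stair q u))))
    ≡⟨ ∑₂-cong c (λ b c₂ → trans
         (cong (isPos a *_) (trans (posSum-* j r₂ (isPos b) _)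
           (cong (isPos b *_) (trans (posSum-* j r₂ (fq q a b) _)
             (cong (fq q a b *_) (sym (chains≡ q j r₂ c₂)))))))
         (reassoc (isPos a) (isPos b) (fq q a b) (chains q j r₂ c₂))) ⟩
  ∑₂ c (λ b c₂ → properBlock q a b * chains q j r₂ c₂) ∎)
  where
  open ≡-Reasoning
  reassoc : ∀ x y z w → x * (y * (z * w)) ≡ x * (y * z) * w
  reassoc = solve 4 (λ x y z w → x :* (y :* (z :* w)) := x :* (y :* z) :* w) refl
    where open +-*-Solver

∑₂-isZero : ∀ l (x : ℕ → ℕ) → ∑₂ l (λ a r → isZero r * x a) ≡ x l
∑₂-isZero zero x = trans (ℕ.+-identityʳ _) (ℕ.*-identityˡ (x 0))
∑₂-isZero (suc l) x = begin
  ∑₂ (suc l) (λ a r → isZero r * x a)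
    ≡⟨ ∑₂-suc l (λ a r → isZero r * x a) ⟩
  ∑₂ l (λ a r → isZero r * x (suc a)) + ∑₂ l (λ a r → 0)
    ≡⟨ cong₂ _+_ (∑₂-isZero l (x ∘ suc)) (∑-zero (bipartitions l)) ⟩
  x (suc l) + 0
    ≡⟨ ℕ.+-identityʳ _ ⟩
  x (suc l) ∎
  where open ≡-Reasoning

-- The bound `f` on the number of peels serves as fuel for the recursion; terms with j beyond min(r,
-- c) are zero, as each peel takes a row and a column.
chainTotal : ℕ → ℕ → ℕ → ℕ → ℕ
chainTotal q f r c = ∑ (upTo f) (λ j → chains q j r c)

chainTotal-suc : ∀ q f r c → chainTotal q (suc f) r c ≡
  isZero r * isZero c + ∑₂ r λ r₁ r₂ → ∑₂ c λ c₁ c₂ → properBlock q r₁ c₁ * chainTotal q f r₂ c₂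
chainTotal-suc q f r c = trans (∑-upTo-suc f _) (cong (isZero r * isZero c +_) (begin
  ∑ (upTo f) (λ j → ∑₂ r λ r₁ r₂ → ∑₂ c λ c₁ c₂ → properBlock q r₁ c₁ * chains q j r₂ c₂)
    ≡⟨ ∑-comm (upTo f) (bipartitions r) _ ⟩
  ∑₂ r (λ r₁ r₂ → ∑ (upTo f) λ j → ∑₂ c λ c₁ c₂ → properBlock q r₁ c₁ * chains q j r₂ c₂)
    ≡⟨ ∑₂-cong r (λ r₁ r₂ → trans (∑-comm (upTo f) (bipartitions c) _)
         (∑₂-cong c λ c₁ c₂ → ∑-* (upTo f) (properBlock q r₁ c₁) _)) ⟩
  ∑₂ r (λ r₁ r₂ → ∑₂ c λ c₁ c₂ → properBlock q r₁ c₁ * chainTotal q f r₂ c₂) ∎))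
  where open ≡-Reasoning

lonesumCount≡ : ∀ q m n → lonesumCount q m n ≡
  ∑₂ m λ _ r → ∑₂ n λ _ c → chainTotal q (suc (m ⊓ n)) r c
lonesumCount≡ q m n = begin
  1 + sum (map (λ j → sum (concatMap (terms j) (S m j))) (map suc (upTo (m ⊓ n))))
    ≡⟨ cong suc (∑-map suc (upTo (m ⊓ n)) (λ j → sum (concatMap (terms j) (S m j)))) ⟩
  1 + ∑ (upTo (m ⊓ n)) (λ j → sum (concatMap (terms (suc j)) (S m (suc j))))
    ≡⟨ cong₂ _+_ (sym base) (∑-cong (upTo (m ⊓ n)) (step ∘ suc)) ⟩
  T 0 + ∑ (upTo (m ⊓ n)) (T ∘ suc)
    ≡⟨ ∑-upTo-suc (m ⊓ n) T ⟨
  ∑ (upTo (suc (m ⊓ n))) T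
    ≡⟨ ∑-comm (upTo (suc (m ⊓ n))) (bipartitions m) _ ⟩
  ∑₂ m (λ _ r → ∑ (upTo (suc (m ⊓ n))) λ j → ∑₂ n λ _ c → chains q j r c)
    ≡⟨ ∑₂-cong m (λ _ r → ∑-comm (upTo (suc (m ⊓ n))) (bipartitions n) _) ⟩
  ∑₂ m (λ _ r → ∑₂ n λ _ c → chainTotal q (suc (m ⊓ n)) r c) ∎
  where
  open ≡-Reasoning
  T : ℕ → ℕ
  T j = ∑₂ m λ _ r → ∑₂ n λ _ c → chains q j r c
  terms : ∀ j → Vec ℕ (suc j) → List ℕ
  terms j mv = map (λ nv → multinomial mv * multinomial nv * prodF q j mv nv) (S n j)
  -- The separate 1 of the formula is the missing term j = 0, which stands for the zero matrix.
  base : T 0 ≡ 1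
  base = trans (∑₂-cong m λ _ r → trans (∑-* (bipartitions n) (isZero r) _)
      (cong (isZero r *_) (trans (∑₂-cong n λ _ c → sym (ℕ.*-identityʳ (isZero c))) (∑₂-isZero n (const 1)))))
    (∑₂-isZero m (const 1))
  sum-concatMap : ∀ {X : Set} (g : X → List ℕ) L → sum (concatMap g L) ≡ ∑ L (sum ∘ g)
  sum-concatMap g [] = refl
  sum-concatMap g (x ∷ L) = trans (sum-++ (g x) _) (cong (sum (g x) +_) (sum-concatMap g L))
  step : ∀ j → sum (concatMap (terms j) (S m j)) ≡ T j
  step j = begin
    sum (concatMap (terms j) (S m j))
      ≡⟨ sum-concatMap (terms j) (S m j) ⟩
    ∑ (S m j) (λ mv → ∑ (S n j) λ nv → multinomial mv * multinomial nv * prodF q j mv nv)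
      ≡⟨ ∑-cong (S m j) (λ mv → trans
           (∑-cong (S n j) λ nv → ℕ.*-assoc (multinomial mv) (multinomial nv) _)
           (trans (∑-* (S n j) (multinomial mv) _)
             (cong (multinomial mv *_) (∑-S n j (prodF q j mv))))) ⟩
    ∑ (S m j) (λ mv → multinomial mv * ∑₂ n λ b c → posSum j c λ v → prodF q j mv (b ∷ v))
      ≡⟨ ∑-S m j _ ⟩
    ∑₂ m (λ a r → posSum j r λ u → ∑₂ n λ b c → posSum j c λ v → prodF q j (a ∷ u) (b ∷ v))
      ≡⟨ ∑₂-cong m (λ a r → posSum-∑ j r (bipartitions n) _) ⟩
    ∑₂ m (λ a r → ∑₂ n λ b c → posSum j r λ u → posSum j c λ v → stair q u v)
      ≡⟨ ∑₂-cong m (λ a r → ∑₂-cong n λ b c → chains≡ q j r c) ⟨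
    T j ∎

-- Entries, supports and blocks

private variable
  m p q : ℕ

at : Matrix q m n → Fin m → Fin n → Fin q
at M i j = lookup (lookup M i) j

pos : Fin q → Bool
pos zero = false
pos (suc _) = true

isTop : Fin q → Bool
isTop {suc zero} zero = true
isTop {suc (suc _)} zero = false
isTop {suc (suc _)} (suc x) = isTop x

-- In a block of positive entries every entry can be lowered, and the mid ones are those that can
-- also be raised.
mid : Fin q → Bool
mid x = pos x ∧ not (isTop x)

isTop-fromℕ : ∀ n → isTop (fromℕ n) ≡ true
isTop-fromℕ zero = refl
isTop-fromℕ (suc n) = isTop-fromℕ n

isTop⇒≡fromℕ : ∀ {n} (x : Fin (suc n)) → isTop x ≡ true → x ≡ fromℕ n
isTop⇒≡fromℕ {zero} zero _ = refl
isTop⇒≡fromℕ {suc n} (suc x) eq = cong suc (isTop⇒≡fromℕ x eq)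

pos≡false⇒≡zero : (x : Fin (suc q)) → pos x ≡ false → x ≡ zero
pos≡false⇒≡zero zero _ = refl

mid⇒pos : (x : Fin q) → mid x ≡ true → pos x ≡ true
mid⇒pos (suc x) _ = refl

pos∧isTop≡false⇒mid : (x : Fin q) → pos x ≡ true → isTop x ≡ false → mid x ≡ true
pos∧isTop≡false⇒mid x eq eq′ rewrite eq | eq′ = refl

pos∧¬mid⇒isTop : (x : Fin q) → pos x ≡ true → mid x ≢ true → isTop x ≡ true
pos∧¬mid⇒isTop (suc x) _ ¬mid with isTop (suc x)
... | true = refl
... | false = contradiction refl ¬mid

mid⇒isTop≡false : (x : Fin q) → mid x ≡ true → isTop x ≡ false
mid⇒isTop≡false (suc x) eq with isTop (suc x)
... | false = refl

≢true⇒≡false : ∀ {b} → b ≢ true → b ≡ false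
≢true⇒≡false = Bool.¬-not

true≢false : ∀ {b} → b ≡ true → b ≡ false → ⊥
true≢false refl ()

card-Fin : ∀ n → Card {Fin n} (λ _ → ⊤) n
card-Fin n = card
  (record { unique = Unique.allFin⁺ n ; sound = λ _ → tt ; complete = λ {x} _ → ∈-allFin x })
  (List.length-tabulate id)

isTop-inject₁ : (x : Fin n) → isTop (inject₁ x) ≡ false
isTop-inject₁ zero = refl
isTop-inject₁ (suc x) = isTop-inject₁ x

inject₁-preimage : (x : Fin (suc n)) → isTop x ≡ false → ∃ λ y → x ≡ inject₁ y
inject₁-preimage {suc n} zero _ = zero , refl
inject₁-preimage {suc n} (suc x) eq =
  let y , eq′ = inject₁-preimage x eq in suc y , cong suc eq′

card-pos : Card {Fin (suc n)} (λ x → pos x ≡ true) n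
card-pos = card-cong (λ { (x , _ , refl) → refl }) (λ { {suc x} _ → x , tt , refl })
  (card-image suc (λ _ _ → Fin.suc-injective) (card-Fin _))

card-mid : Card {Fin (suc (suc p))} (λ x → mid x ≡ true) p
card-mid = card-cong
  (λ { (x , _ , refl) → cong not (isTop-inject₁ x) })
  (λ { {suc x} eq → let y , eq′ = inject₁-preimage x (mid⇒isTop≡false (suc x) eq) in y , tt , cong suc eq′ })
  (card-image (suc ∘ inject₁) (λ _ _ eq → Fin.inject₁-injective (Fin.suc-injective eq)) (card-Fin _))

lookup-ext : {v w : Vec A n} → (∀ i → lookup v i ≡ lookup w i) → v ≡ w
lookup-ext {v = []} {[]} _ = refl
lookup-ext {v = _ ∷ _} {_ ∷ _} eq = cong₂ _∷_ (eq zero) (lookup-ext (eq ∘ suc))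

count≡0⇒false : ∀ (b : Vec Bool n) → count b ≡ 0 → ∀ i → lookup b i ≡ false
count≡0⇒false (false ∷ b) eq zero = refl
count≡0⇒false (false ∷ b) eq (suc i) = count≡0⇒false b eq i

false⇒count≡0 : ∀ (b : Vec Bool n) → (∀ i → lookup b i ≡ false) → count b ≡ 0
false⇒count≡0 [] f = refl
false⇒count≡0 (true ∷ b) f = ⊥-elim (true≢false refl (f zero))
false⇒count≡0 (false ∷ b) f = false⇒count≡0 b (f ∘ suc)

count≥1⇒∃true : ∀ (b : Vec Bool n) → 1 ≤ count b → ∃ λ i → lookup b i ≡ true
count≥1⇒∃true (true ∷ b) _ = zero , refl
count≥1⇒∃true (false ∷ b) le = let i , t = count≥1⇒∃true b le in suc i , t

∃true⇒count≥1 : ∀ (b : Vec Bool n) {i} → lookup b i ≡ true → 1 ≤ count b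
∃true⇒count≥1 (true ∷ b) _ = s≤s z≤n
∃true⇒count≥1 (false ∷ b) {suc i} t = ∃true⇒count≥1 b t

count≡1⇒true-unique : ∀ (b : Vec Bool n) → count b ≡ 1 → ∀ {i j} →
  lookup b i ≡ true → lookup b j ≡ true → i ≡ j
count≡1⇒true-unique (true ∷ b) eq {zero} {zero} _ _ = refl
count≡1⇒true-unique (true ∷ b) eq {zero} {suc j} _ t =
  ⊥-elim (true≢false t (count≡0⇒false b (ℕ.suc-injective eq) j))
count≡1⇒true-unique (true ∷ b) eq {suc i} t _ =
  ⊥-elim (true≢false t (count≡0⇒false b (ℕ.suc-injective eq) i))
count≡1⇒true-unique (false ∷ b) eq {suc i} {suc j} t t′ =
  cong suc (count≡1⇒true-unique b eq t t′)

count≥2⇒∃true≢ : ∀ (b : Vec Bool n) → 2 ≤ count b → ∀ k → ∃ λ i → i ≢ k × lookup b i ≡ true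
count≥2⇒∃true≢ (true ∷ b) (s≤s le) zero =
  let i , t = count≥1⇒∃true b le in suc i , (λ ()) , t
count≥2⇒∃true≢ (true ∷ b) _ (suc k) = zero , (λ ()) , refl
count≥2⇒∃true≢ (false ∷ b) le zero =
  let i , t = count≥1⇒∃true b (ℕ.<⇒≤ le) in suc i , (λ ()) , t
count≥2⇒∃true≢ (false ∷ b) le (suc k) =
  let i , ≢ , t = count≥2⇒∃true≢ b le k in suc i , ≢ ∘ Fin.suc-injective , t

-- Rows of given support, counted by their mid entries

Supported : Vec Bool n → Vec (Fin q) n → Set
Supported K v = ∀ j → pos (lookup v j) ≡ lookup K j

mids : Vec (Fin q) n → Vec Bool n
mids = Vec.map mid

lookup-mids : (v : Vec (Fin q) n) → ∀ j → lookup (mids v) j ≡ mid (lookup v j)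
lookup-mids v j = Vec.lookup-map j mid v

-- The predicate `D` is a parameter so that one recursion along the row serves for all conditions on
-- the number of mid entries.
WithMids : Vec Bool n → (ℕ → Set) → Vec (Fin q) n → Set
WithMids K D v = Supported K v × D (count (mids v))

card-false∷ : ∀ {K : Vec Bool n} {D k} → Card {Vec (Fin (suc q)) n} (WithMids K D) k →
  Card {Vec (Fin (suc q)) (suc n)} (WithMids (false ∷ K) D) k
card-false∷ {D = D} c = card-cong
  (λ { (v , (s , d) , refl) → (λ { zero → refl ; (suc j) → s j }) , d })
  (λ { {zero ∷ v} (s , d) → v , (s ∘ suc , d) , refl ; {suc _ ∷ v} (s , _) → contradiction (s zero) λ () })
  (card-image (zero ∷_) (λ _ _ → Vec.∷-injectiveʳ) c)

-- A positive entry is either q - 1 or one of the p = q - 2 mid values; the latter adds one to the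
-- number of mid entries, hence `D ∘ suc`.
card-true∷ : ∀ {K : Vec Bool n} {D k l} → Card {Vec (Fin (suc (suc p))) n} (WithMids K D) k →
  Card {Vec (Fin (suc (suc p))) n} (WithMids K (D ∘ suc)) l →
  Card {Vec (Fin (suc (suc p))) (suc n)} (WithMids (true ∷ K) D) (k + p * l)
card-true∷ {n} {p} {K} {D} c c′ = card-cong to from
  (card-⊎ disj (card-image (fromℕ (suc p) ∷_) (λ _ _ → Vec.∷-injectiveʳ) c)
    (card-∷ {P = λ x v → mid x ≡ true × WithMids K (D ∘ suc) v} (card-× card-mid λ _ → c′)))
  where
  Top Mid : Vec (Fin (suc (suc p))) (suc n) → Set
  Top w = ∃ λ v → WithMids K D v × w ≡ fromℕ (suc p) ∷ v
  Mid w = mid (head w) ≡ true × WithMids K (D ∘ suc) (tail w)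
  disj : ∀ {w} → Top w → Mid w → ⊥
  disj (v , _ , refl) (mid≡ , _) = true≢false (isTop-fromℕ p) (mid⇒isTop≡false (fromℕ (suc p)) mid≡)
  count-top : ∀ (v : Vec (Fin (suc (suc p))) n) x → isTop x ≡ true → (count (mids (x ∷ v))) ≡ (count (mids v))
  count-top v zero ()
  count-top v (suc x) eq rewrite eq = refl
  count-mid : ∀ (v : Vec (Fin (suc (suc p))) n) x → mid x ≡ true → (count (mids (x ∷ v))) ≡ suc (count (mids v))
  count-mid v x eq rewrite eq = refl
  to : ∀ {w} → Top w ⊎ Mid w → WithMids (true ∷ K) D w
  to (inj₁ (v , (s , d) , refl)) =
    (λ { zero → refl ; (suc j) → s j }) , subst D (sym (count-top v (fromℕ (suc p)) (isTop-fromℕ p))) d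
  to {x ∷ v} (inj₂ (eq , s , d)) =
    (λ { zero → mid⇒pos x eq ; (suc j) → s j }) , subst D (sym (count-mid v x eq)) d
  from : ∀ {w} → WithMids (true ∷ K) D w → Top w ⊎ Mid w
  from {x ∷ v} (s , d) = split _ refl
    where
    split : ∀ b → isTop x ≡ b → Top (x ∷ v) ⊎ Mid (x ∷ v)
    split true eq =
      inj₁ (v , (s ∘ suc , subst D (count-top v x eq) d) , cong (_∷ v) (isTop⇒≡fromℕ x eq))
    split false eq = inj₂ (mid≡ , s ∘ suc , subst D (count-mid v x mid≡) d)
      where
      mid≡ : mid x ≡ true
      mid≡ = pos∧isTop≡false⇒mid x (s zero) eq

-- Subtraction-free versions of `suc p ^ s - 1` and `suc p ^ s - p * s - 1`; the recursions are
-- those of `card-true∷`.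
atLeastOneMid atLeastTwoMids : ℕ → ℕ → ℕ
atLeastOneMid p zero = 0
atLeastOneMid p (suc s) = atLeastOneMid p s + p * suc p ^ s
atLeastTwoMids p zero = 0
atLeastTwoMids p (suc s) = atLeastTwoMids p s + p * atLeastOneMid p s

RowCard : ℕ → ∀ {n} → Vec Bool n → (ℕ → Set) → ℕ → Set
RowCard p {n} K D k = Card {Vec (Fin (suc (suc p))) n} (WithMids K D) k

rowCard-cong : ∀ (K : Vec Bool n) (D D′ : ℕ → Set) {k} → (∀ {x} → D x → D′ x) → (∀ {x} → D′ x → D x) →
  RowCard p K D k → RowCard p K D′ k
rowCard-cong K D D′ f g = card-cong (λ (s , d) → s , f d) (λ (s , d) → s , g d)

row-any : (K : Vec Bool n) → RowCard p K (λ _ → ⊤) (suc p ^ count K)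
row-any [] = card-cong (λ _ → (λ ()) , tt) (λ { {[]} _ → refl }) (card-single [])
row-any (true ∷ K) = card-true∷ {D = λ _ → ⊤} (row-any K) (row-any K)
row-any (false ∷ K) = card-false∷ {D = λ _ → ⊤} (row-any K)

row-none : (K : Vec Bool n) → RowCard p K (_≡ 0) 1
row-none [] = card-cong (λ { refl → (λ ()) , refl }) (λ { {[]} _ → refl }) (card-single [])
row-none {p = p} (true ∷ K) = subst (RowCard p (true ∷ K) (_≡ 0)) (cong suc (ℕ.*-zeroʳ p))
  (card-true∷ {D = _≡ 0} (row-none K) (card-empty λ ()))
row-none (false ∷ K) = card-false∷ {D = _≡ 0} (row-none K)

row-≥1 : (K : Vec Bool n) → RowCard p K (1 ≤_) (atLeastOneMid p (count K))
row-≥1 [] = card-empty λ { {[]} () }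
row-≥1 (true ∷ K) = card-true∷ {D = 1 ≤_} (row-≥1 K)
  (rowCard-cong K (λ _ → ⊤) (λ x → 1 ≤ suc x) (λ _ → s≤s z≤n) (λ _ → tt) (row-any K))
row-≥1 (false ∷ K) = card-false∷ {D = 1 ≤_} (row-≥1 K)

row-≥2 : (K : Vec Bool n) → RowCard p K (2 ≤_) (atLeastTwoMids p (count K))
row-≥2 [] = card-empty λ { {[]} () }
row-≥2 (true ∷ K) = card-true∷ {D = 2 ≤_} (row-≥2 K) (rowCard-cong K (1 ≤_) (λ x → 2 ≤ suc x) s≤s s≤s⁻¹ (row-≥1 K))
row-≥2 (false ∷ K) = card-false∷ {D = 2 ≤_} (row-≥2 K)

row-one : (K : Vec Bool n) → RowCard p K (_≡ 1) (count K * p)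
row-one [] = card-empty λ { {[]} () }
row-one {p = p} (true ∷ K) = subst (RowCard p (true ∷ K) (_≡ 1))
  (trans (cong (count K * p +_) (ℕ.*-identityʳ p)) (ℕ.+-comm (count K * p) p))
  (card-true∷ {D = _≡ 1} (row-one K) (rowCard-cong K (_≡ 0) (λ x → suc x ≡ 1) (cong suc) ℕ.suc-injective (row-none K)))
row-one (false ∷ K) = card-false∷ {D = _≡ 1} (row-one K)

-- Blocks: all mid entries lie in a single row or a single column

Block : Vec Bool m → Vec Bool n → Matrix q m n → Set
Block R K M = ∀ i j → pos (at M i j) ≡ lookup R i ∧ lookup K j

-- Two mid entries in different rows and columns of a block could be raised together, the other two
-- corners of their rectangle being positive. Pairwise avoidance already puts all of them on one
-- line.
MidLine : Matrix q m n → Set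
MidLine M = ∀ i i′ j j′ → mid (at M i j) ≡ true → mid (at M i′ j′) ≡ true → i ≢ i′ → j ≢ j′ → ⊥

MidsIn : Vec Bool n → Matrix q m n → Set
MidsIn b M = ∀ i j → mid (at M i j) ≡ true → lookup b j ≡ true

zeroRow : ∀ n → Vec (Fin (suc q)) n
zeroRow n = Vec.replicate n zero

lookup-zeroRow : ∀ j → lookup (zeroRow {q} n) j ≡ zero
lookup-zeroRow j = Vec.lookup-replicate j zero

-- Columns in `b` admit all `suc p` positive values, those of `K` outside `b` only q - 1, and the
-- others only 0.
card-row-midsIn : ∀ (K b : Vec Bool n) → (∀ j → lookup b j ≡ true → lookup K j ≡ true) →
  Card {Vec (Fin (suc (suc p))) n}
    (λ v → ∀ j → pos (lookup v j) ≡ lookup K j × (mid (lookup v j) ≡ true → lookup b j ≡ true))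
    (suc p ^ count b)
card-row-midsIn {n} {p} K b b⊆K = card-lookup b (λ j → go j (lookup b j) refl (lookup K j) refl)
  where
  go : ∀ j x → lookup b j ≡ x → ∀ y → lookup K j ≡ y →
    Card {Fin (suc (suc p))} (λ e → pos e ≡ lookup K j × (mid e ≡ true → lookup b j ≡ true))
      (if lookup b j then suc p else 1)
  go j true eq y eq′ rewrite eq | b⊆K j eq = card-cong (_, λ _ → refl) proj₁ card-pos
  go j false eq true eq′ rewrite eq | eq′ = card-cong
    (λ { refl → refl , λ m → ⊥-elim (true≢false (isTop-fromℕ (suc p)) (mid⇒isTop≡false (fromℕ (suc p)) m)) })
    (λ {e} (pos≡ , ¬mid) → isTop⇒≡fromℕ e (pos∧¬mid⇒isTop e pos≡ λ m → true≢false (¬mid m) refl))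
    (card-single (fromℕ (suc p)))
  go j false eq false eq′ rewrite eq | eq′ = card-cong
    (λ { refl → refl , λ () }) (λ {e} (pos≡ , _) → pos≡false⇒≡zero e pos≡) (card-single zero)

card-midsIn : ∀ (R : Vec Bool m) (K b : Vec Bool n) → (∀ j → lookup b j ≡ true → lookup K j ≡ true) →
  Card {Matrix (suc (suc p)) m n} (λ M → Block R K M × MidsIn b M) ((suc p ^ count b) ^ count R)
card-midsIn {m} {n} {p} R K b b⊆K = card-cong
  {P = λ M → ∀ i j → RowOk (lookup R i) (lookup M i) j}
  (λ f → (λ i j → proj₁ (f i j)) , λ i j → proj₂ (f i j))
  (λ (f , g) i j → f i j , g i j)
  (card-lookup R {P = λ i v → ∀ j → RowOk (lookup R i) v j} (λ i → go (lookup R i)))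
  where
  RowOk : Bool → Vec (Fin (suc (suc p))) n → Fin n → Set
  RowOk r v j = pos (lookup v j) ≡ r ∧ lookup K j × (mid (lookup v j) ≡ true → lookup b j ≡ true)
  go : ∀ r → Card (λ v → ∀ j → RowOk r v j) (if r then suc p ^ count b else 1)
  go true = card-row-midsIn K b b⊆K
  go false = card-cong
    (λ { refl j → cong pos (lookup-zeroRow j) ,
                  λ m → ⊥-elim (true≢false m (cong mid (lookup-zeroRow j))) })
    (λ f → lookup-ext λ j → trans (pos≡false⇒≡zero _ (proj₁ (f j))) (sym (lookup-zeroRow j)))
    (card-single (zeroRow n))

-- The three summands distinguish a first row with no, at least two, or exactly one mid entry. Two
-- or more leave no mid entry below; a single one, chosen in `s * p` ways, confines the others to
-- its column, where each of the `r` rows has `suc p` choices.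
blockCount : ℕ → ℕ → ℕ → ℕ
blockCount p zero s = 1
blockCount p (suc r) s =
  blockCount p r s + (atLeastTwoMids p s + s * p * suc p ^ r)

card-block : ∀ (R : Vec Bool m) (K : Vec Bool n) →
  Card {Matrix (suc (suc p)) m n} (λ M → Block R K M × MidLine M) (blockCount p (count R) (count K))
card-block [] K =
  card-cong (λ _ → (λ ()) , λ ()) (λ { {[]} _ → refl }) (card-single [])
card-block {n = n} {p} (false ∷ R) K = card-cong
  (λ { (M , (B , L) , refl) →
       (λ { zero j → cong pos (lookup-zeroRow j) ; (suc i) j → B i j }) , extend M L })
  (λ { {v ∷ M} (B , L) → M , (B ∘ suc , λ i i′ j j′ m m′ i≢ → L (suc i) (suc i′) j j′ m m′ (i≢ ∘ Fin.suc-injective)) ,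
       cong (_∷ M) (lookup-ext λ j → trans (pos≡false⇒≡zero _ (B zero j)) (sym (lookup-zeroRow j))) })
  (card-image (zeroRow n ∷_) (λ _ _ → Vec.∷-injectiveʳ) (card-block R K))
  where
  noMid : ∀ {j} → mid (lookup (zeroRow {suc p} n) j) ≡ true → ⊥
  noMid {j} m = true≢false m (cong mid (lookup-zeroRow j))
  extend : (M : Matrix (suc (suc p)) _ n) → MidLine M → MidLine (zeroRow n ∷ M)
  extend M L zero _ _ _ m _ _ _ = noMid m
  extend M L (suc i) zero _ _ _ m′ _ _ = noMid m′
  extend M L (suc i) (suc i′) j j′ m m′ i≢ = L i i′ j j′ m m′ (i≢ ∘ cong suc)
card-block {suc m} {n} {p} (true ∷ R) K = card-cong (λ {M} → to {M}) (λ {M} → from {M})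
  (card-⊎ (λ {M} → disj {M}) (subst (Card _) (ℕ.*-identityˡ _) cardNone) (card-⊎ (λ {M} → disj′ {M}) (subst (Card _) eqTwo cardTwo) cardOne))
  where
  Q : ℕ
  Q = suc (suc p)
  none : Vec Bool n
  none = Vec.replicate n false
  none≢true : ∀ {j} → lookup none j ≡ true → ⊥
  none≢true {j} t = true≢false t (Vec.lookup-replicate j false)
  FirstNone FirstTwo FirstOne : Matrix Q (suc m) n → Set
  FirstNone M = WithMids K (_≡ 0) (head M) × (Block R K (tail M) × MidLine (tail M))
  FirstTwo M = WithMids K (2 ≤_) (head M) × (Block R K (tail M) × MidsIn none (tail M))
  FirstOne M = WithMids K (_≡ 1) (head M) × (Block R K (tail M) × MidsIn (mids (head M)) (tail M))
  disj : ∀ {M} → FirstNone M → FirstTwo M ⊎ FirstOne M → ⊥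
  disj ((_ , eq) , _) (inj₁ ((_ , le) , _)) = contradiction (subst (2 ≤_) eq le) λ ()
  disj ((_ , eq) , _) (inj₂ ((_ , eq′) , _)) = contradiction (trans (sym eq) eq′) λ ()
  disj′ : ∀ {M} → FirstTwo M → FirstOne M → ⊥
  disj′ ((_ , le) , _) ((_ , eq) , _) = contradiction (subst (2 ≤_) eq le) λ { (s≤s ()) }
  cardNone : Card FirstNone (1 * blockCount p (count R) (count K))
  cardNone = card-∷ {P = λ v M → WithMids K (_≡ 0) v × (Block R K M × MidLine M)}
    (card-× (row-none K) λ _ → card-block R K)
  cardTwo : Card FirstTwo (atLeastTwoMids p (count K) * (suc p ^ count none) ^ count R)
  cardTwo = card-∷ {P = λ v M → WithMids K (2 ≤_) v × (Block R K M × MidsIn none M)}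
    (card-× (row-≥2 K) λ _ → card-midsIn R K none λ j t → ⊥-elim (none≢true t))
  eqTwo : atLeastTwoMids p (count K) * (suc p ^ count none) ^ count R ≡ atLeastTwoMids p (count K)
  eqTwo = trans (cong (λ k → atLeastTwoMids p (count K) * (suc p ^ k) ^ count R)
                  (false⇒count≡0 none λ j → Vec.lookup-replicate j false))
    (trans (cong (atLeastTwoMids p (count K) *_) (ℕ.^-zeroˡ (count R))) (ℕ.*-identityʳ _))
  cardOne : Card FirstOne (count K * p * suc p ^ count R)
  cardOne = card-∷ {P = λ v M → WithMids K (_≡ 1) v × (Block R K M × MidsIn (mids v) M)}
    (card-× (row-one K) λ {v} (s , eq) →
      subst (Card _) (cong (_^ count R) (trans (cong (suc p ^_) eq) (ℕ.*-identityʳ (suc p))))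
        (card-midsIn R K (mids v) λ j t → trans (sym (s j)) (mid⇒pos _ (trans (sym (lookup-mids v j)) t))))
  block-∷ : ∀ {v} {M : Matrix Q m n} → Supported K v → Block R K M → Block (true ∷ R) K (v ∷ M)
  block-∷ s B zero j = s j
  block-∷ s B (suc i) j = B i j
  inMids : ∀ (v : Vec (Fin Q) n) {j} → mid (lookup v j) ≡ true → lookup (mids v) j ≡ true
  inMids v {j} t = trans (lookup-mids v j) t
  to : ∀ {M} → FirstNone M ⊎ (FirstTwo M ⊎ FirstOne M) → Block (true ∷ R) K M × MidLine M
  to {v ∷ M} (inj₁ ((s , eq) , B , L)) = block-∷ s B , line
    where
    noMid : ∀ {j} → mid (lookup v j) ≡ true → ⊥
    noMid {j} t = true≢false (inMids v t) (count≡0⇒false (mids v) eq j)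
    line : MidLine (v ∷ M)
    line zero _ _ _ t _ _ _ = noMid t
    line (suc i) zero _ _ _ t′ _ _ = noMid t′
    line (suc i) (suc i′) j j′ t t′ i≢ = L i i′ j j′ t t′ (i≢ ∘ cong suc)
  to {v ∷ M} (inj₂ (inj₁ ((s , _) , B , I))) = block-∷ s B , line
    where
    line : MidLine (v ∷ M)
    line zero zero _ _ _ _ i≢ _ = i≢ refl
    line zero (suc i′) _ j′ _ t′ _ _ = none≢true (I i′ j′ t′)
    line (suc i) _ j _ t _ _ _ = none≢true (I i j t)
  to {v ∷ M} (inj₂ (inj₂ ((s , eq) , B , I))) = block-∷ s B , line
    where
    inFirst : ∀ i {j} → mid (at (v ∷ M) i j) ≡ true → lookup (mids v) j ≡ true
    inFirst zero t = inMids v t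
    inFirst (suc i) t = I i _ t
    line : MidLine (v ∷ M)
    line i i′ _ _ t t′ _ j≢ = j≢ (count≡1⇒true-unique (mids v) eq (inFirst i t) (inFirst i′ t′))
  from : ∀ {M} → Block (true ∷ R) K M × MidLine M → FirstNone M ⊎ (FirstTwo M ⊎ FirstOne M)
  from {v ∷ M} (B , L) = split (count (mids v)) refl
    where
    split : ∀ k → count (mids v) ≡ k → FirstNone (v ∷ M) ⊎ (FirstTwo (v ∷ M) ⊎ FirstOne (v ∷ M))
    split 0 eq = inj₁ ((B zero , eq) , B ∘ suc , λ i i′ j j′ t t′ i≢ → L (suc i) (suc i′) j j′ t t′ (i≢ ∘ Fin.suc-injective))
    split 1 eq = inj₂ (inj₂ ((B zero , eq) , B ∘ suc , sub))
      where
      sub : MidsIn (mids v) M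
      sub i j t with count≥1⇒∃true (mids v) (subst (1 ≤_) (sym eq) (s≤s z≤n))
      ... | j′ , t′ with j′ Fin.≟ j
      ...   | yes refl = t′
      ...   | no j′≢j = ⊥-elim (L zero (suc i) j′ j (trans (sym (lookup-mids v j′)) t′) t (λ ()) j′≢j)
    split (suc (suc k)) eq = inj₂ (inj₁ ((B zero , subst (2 ≤_) (sym eq) (s≤s (s≤s z≤n))) , B ∘ suc , sub))
      where
      -- One of the mid entries of the first row lies outside column `j`, so a mid entry of a lower
      -- row in column `j` would cross it.
      sub : MidsIn none M
      sub i j t with count≥2⇒∃true≢ (mids v) (subst (2 ≤_) (sym eq) (s≤s (s≤s z≤n))) j
      ... | j′ , j′≢j , t′ = ⊥-elim (L zero (suc i) j′ j (trans (sym (lookup-mids v j′)) t′) t (λ ()) j′≢j)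

-- Closed form of the block count

atLeastOneMid≡ : ∀ p s → suc (atLeastOneMid p s) ≡ suc p ^ s
atLeastOneMid≡ p zero = refl
atLeastOneMid≡ p (suc s) = cong (_+ p * suc p ^ s) (atLeastOneMid≡ p s)

-- The difference `p * s` counts the rows with exactly one mid entry: a position and one of `p`
-- values.
atLeastOneMid-split : ∀ p s → atLeastOneMid p s ≡ atLeastTwoMids p s + p * s
atLeastOneMid-split p zero = sym (ℕ.*-zeroʳ p)
atLeastOneMid-split p (suc s) = begin
  atLeastOneMid p s + p * suc p ^ s
    ≡⟨ cong₂ (λ x y → x + p * y) (atLeastOneMid-split p s) (sym (atLeastOneMid≡ p s)) ⟩
  (atLeastTwoMids p s + p * s) + p * suc (atLeastOneMid p s)
    ≡⟨ solve 4 (λ w p s v → (w :+ p :* s) :+ p :* (con 1 :+ v) := (w :+ p :* v) :+ p :* (con 1 :+ s))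
         refl (atLeastTwoMids p s) p s (atLeastOneMid p s) ⟩
  (atLeastTwoMids p s + p * atLeastOneMid p s) + p * suc s ∎
  where
  open ≡-Reasoning
  open +-*-Solver

-- The truncated subtractions in `fq` are exact, as `suc p ^ s` is a sum of three parts: no mid
-- entry, exactly one, at least two.
atLeastTwoMids≡ : ∀ p s → (suc p ^ s ∸ p * s) ∸ 1 ≡ atLeastTwoMids p s
atLeastTwoMids≡ p s = begin
  (suc p ^ s ∸ p * s) ∸ 1
    ≡⟨ cong (λ x → (x ∸ p * s) ∸ 1) (trans (sym (atLeastOneMid≡ p s)) (cong suc (atLeastOneMid-split p s))) ⟩
  ((suc (atLeastTwoMids p s) + p * s) ∸ p * s) ∸ 1
    ≡⟨ cong (_∸ 1) (ℕ.m+n∸n≡m (suc (atLeastTwoMids p s)) (p * s)) ⟩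
  atLeastTwoMids p s ∎
  where open ≡-Reasoning

-- The four terms count the blocks with no mid entry, with exactly one, with at least two in one
-- row, and with at least two in one column. This is the origin of f_q.
blockCount-closed : ∀ p r s →
  blockCount p r s ≡ 1 + p * r * s + r * atLeastTwoMids p s + s * atLeastTwoMids p r
blockCount-closed p zero s =
  solve 2 (λ p s → con 1 := con 1 :+ p :* con 0 :* s :+ con 0 :+ s :* con 0) refl p s
  where open +-*-Solver
blockCount-closed p (suc r) s = begin
  blockCount p r s + (W s + s * p * suc p ^ r)
    ≡⟨ cong₂ (λ x y → x + (W s + s * p * y)) (blockCount-closed p r s) (sym (atLeastOneMid≡ p r)) ⟩
  (1 + p * r * s + r * W s + s * W r) + (W s + s * p * suc (atLeastOneMid p r))
    ≡⟨ solve 6 (λ p r s ws wr v →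
         (con 1 :+ p :* r :* s :+ r :* ws :+ s :* wr) :+ (ws :+ s :* p :* (con 1 :+ v)) :=
         con 1 :+ p :* (con 1 :+ r) :* s :+ (con 1 :+ r) :* ws :+ s :* (wr :+ p :* v))
         refl p r s (W s) (W r) (atLeastOneMid p r) ⟩
  1 + p * suc r * s + suc r * W s + s * W (suc r) ∎
  where
  open ≡-Reasoning
  open +-*-Solver
  W : ℕ → ℕ
  W = atLeastTwoMids p

blockCount≡fq : ∀ p r s → blockCount p r s ≡ fq (suc (suc p)) r s
blockCount≡fq p r s = trans (blockCount-closed p r s)
  (sym (cong₂ (λ x y → 1 + p * r * s + r * x + s * y) (atLeastTwoMids≡ p s) (atLeastTwoMids≡ p r)))

NonEmpty : Vec Bool n → Set
NonEmpty b = ∃ λ i → lookup b i ≡ true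

card-properBlock : ∀ (R : Vec Bool m) (K : Vec Bool n) →
  Card {Matrix (suc (suc p)) m n}
    (λ M → NonEmpty R × NonEmpty K × Block R K M × MidLine M)
    (properBlock (suc (suc p)) (count R) (count K))
card-properBlock {p = p} R K = go _ refl _ refl
  where
  empty : ∀ {b : Vec Bool n} → count b ≡ 0 → NonEmpty b → ⊥
  empty {b = b} eq (i , t) = true≢false t (count≡0⇒false b eq i)
  go : ∀ k → count R ≡ k → ∀ l → count K ≡ l → Card (λ M → NonEmpty R × NonEmpty K × Block R K M × MidLine M)
    (properBlock (suc (suc p)) (count R) (count K))
  go zero eq l eq′ rewrite eq = card-empty λ (r , _) → empty {b = R} eq r
  go (suc k) eq zero eq′ rewrite eq | eq′ = card-empty λ (_ , c , _) → empty {b = K} eq′ c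
  go (suc k) eq (suc l) eq′ = card-cong
    (λ (B , L) → count≥1⇒∃true R (subst (1 ≤_) (sym eq) (s≤s z≤n)) ,
                 count≥1⇒∃true K (subst (1 ≤_) (sym eq′) (s≤s z≤n)) , B , L)
    (λ (_ , _ , B , L) → B , L)
    (subst (Card _) (trans (blockCount≡fq p (count R) (count K)) proper) (card-block R K))
    where
    proper : fq (suc (suc p)) (count R) (count K) ≡ properBlock (suc (suc p)) (count R) (count K)
    proper rewrite eq | eq′ = sym (trans (ℕ.*-identityˡ _) (ℕ.*-identityˡ _))

-- Peeling off the full rows

Unswitchable : Matrix q m n → Set
Unswitchable M = ∀ i i′ j j′ →
  isTop (at M i j) ≡ false → pos (at M i j′) ≡ true →
  isTop (at M i′ j′) ≡ false → pos (at M i′ j) ≡ true →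
  i ≢ i′ → j ≢ j′ → ⊥

-- `R` and `K` are the sets of nonzero rows and columns, so they are determined by `M`.
record Hull (R : Vec Bool m) (K : Vec Bool n) (M : Matrix q m n) : Set where
  field
    unswitchable : Unswitchable M
    inRow  : ∀ i j → pos (at M i j) ≡ true → lookup R i ≡ true
    inCol  : ∀ i j → pos (at M i j) ≡ true → lookup K j ≡ true
    rowHit : ∀ i → lookup R i ≡ true → ∃ λ j → pos (at M i j) ≡ true
    colHit : ∀ j → lookup K j ≡ true → ∃ λ i → pos (at M i j) ≡ true
open Hull

-- Membership in a set and in the two classes of a partition of it, at one position.
data Part : Bool → Bool → Bool → Set where
  left  : Part true true false
  right : Part true false true
  out   : Part false false false

Split : (R R₁ R₂ : Vec Bool n) → Set
Split R R₁ R₂ = ∀ i → Part (lookup R i) (lookup R₁ i) (lookup R₂ i)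

private variable
  b x y z : Bool

part : (x ≡ true → b ≡ true) → (y ≡ true → b ≡ true) → (x ≡ true → y ≡ true → ⊥) →
  (b ≡ true → x ≡ true ⊎ y ≡ true) → Part b x y
part {true} {true} {true} _ _ d _ = ⊥-elim (d refl refl)
part {true} {true} {false} _ _ _ _ = left
part {true} {false} f _ _ _ = contradiction (f refl) λ ()
part {false} {true} {true} _ _ _ _ = right
part {false} {false} {true} _ f _ _ = contradiction (f refl) λ ()
part {false} {true} {false} _ _ _ c = [ (λ ()) , (λ ()) ]′ (c refl)
part {false} {false} {false} _ _ _ _ = out

part-left : Part b x y → x ≡ true → b ≡ true
part-left left _ = refl

part-right : Part b x y → y ≡ true → b ≡ true
part-right right _ = refl

part-disjoint : Part b x y → x ≡ true → y ≡ true → ⊥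
part-disjoint left _ ()

part-cover : Part b x y → b ≡ true → x ≡ true ⊎ y ≡ true
part-cover left _ = inj₁ refl
part-cover right _ = inj₂ refl

part-uniqueˡ : Part b x z → Part b y z → x ≡ y
part-uniqueˡ left left = refl
part-uniqueˡ right right = refl
part-uniqueˡ out out = refl

part-uniqueʳ : Part b x y → Part b x z → y ≡ z
part-uniqueʳ left left = refl
part-uniqueʳ right right = refl
part-uniqueʳ out out = refl

true-antisym : (x ≡ true → y ≡ true) → (y ≡ true → x ≡ true) → x ≡ y
true-antisym {true} f g = sym (f refl)
true-antisym {false} {true} f g = g refl
true-antisym {false} {false} f g = refl

true∨false : ∀ b → b ≡ true ⊎ b ≡ false
true∨false true = inj₁ refl
true∨false false = inj₂ refl

consˡ consʳ consᵒ : Vec Bool n × Vec Bool n → Vec Bool (suc n) × Vec Bool (suc n)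
consˡ (R₁ , R₂) = true ∷ R₁ , false ∷ R₂
consʳ (R₁ , R₂) = false ∷ R₁ , true ∷ R₂
consᵒ (R₁ , R₂) = false ∷ R₁ , false ∷ R₂

splits : Vec Bool n → List (Vec Bool n × Vec Bool n)
splits [] = ([] , []) ∷ []
splits (true ∷ R) = map consˡ (splits R) ++ map consʳ (splits R)
splits (false ∷ R) = map consᵒ (splits R)

enum-splits : (R : Vec Bool n) → Enum {Vec Bool n × Vec Bool n} (λ (R₁ , R₂) → Split R R₁ R₂) (splits R)
enum-splits [] = enum-cong (λ _ ()) (λ { {[] , []} _ → refl }) (enum-single ([] , []))
enum-splits (true ∷ R) = enum-cong
  (λ { (inj₁ (_ , s , refl)) → λ { zero → left ; (suc i) → s i }
     ; (inj₂ (_ , s , refl)) → λ { zero → right ; (suc i) → s i } })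
  from
  (enum-⊎ (λ { (_ , _ , refl) (_ , _ , ()) })
    (enum-image consˡ (λ { _ _ refl → refl }) (enum-splits R))
    (enum-image consʳ (λ { _ _ refl → refl }) (enum-splits R)))
  where
  from : ∀ {t} → Split (true ∷ R) (proj₁ t) (proj₂ t) →
    (∃ λ s → Split R (proj₁ s) (proj₂ s) × t ≡ consˡ s) ⊎ (∃ λ s → Split R (proj₁ s) (proj₂ s) × t ≡ consʳ s)
  from {x ∷ R₁ , y ∷ R₂} s with x | y | s zero
  ... | true | false | left = inj₁ (_ , s ∘ suc , refl)
  ... | false | true | right = inj₂ (_ , s ∘ suc , refl)
enum-splits (false ∷ R) = enum-cong
  (λ { (_ , s , refl) → λ { zero → out ; (suc i) → s i } })
  from
  (enum-image consᵒ (λ { _ _ refl → refl }) (enum-splits R))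
  where
  from : ∀ {t} → Split (false ∷ R) (proj₁ t) (proj₂ t) → ∃ λ s → Split R (proj₁ s) (proj₂ s) × t ≡ consᵒ s
  from {x ∷ R₁ , y ∷ R₂} s with x | y | s zero
  ... | false | false | out = _ , s ∘ suc , refl

-- At each true position `splits` branches just like `bipartitions`, hence no identity for binomial
-- coefficients enters here.
∑-splits : ∀ (R : Vec Bool n) (h : ℕ → ℕ → ℕ) →
  ∑ (splits R) (λ (R₁ , R₂) → h (count R₁) (count R₂)) ≡ ∑₂ (count R) h
∑-splits [] h = refl
∑-splits (true ∷ R) h = begin
  ∑ (map consˡ (splits R) ++ map consʳ (splits R)) H
    ≡⟨ ∑-++ (map consˡ (splits R)) (map consʳ (splits R)) H ⟩
  ∑ (map consˡ (splits R)) H + ∑ (map consʳ (splits R)) H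
    ≡⟨ cong₂ _+_ (trans (∑-map consˡ (splits R) H) (∑-splits R (h ∘ suc)))
                 (trans (∑-map consʳ (splits R) H) (∑-splits R (λ a r → h a (suc r)))) ⟩
  ∑₂ (count R) (h ∘ suc) + ∑₂ (count R) (λ a r → h a (suc r))
    ≡⟨ ∑₂-suc (count R) h ⟨
  ∑₂ (suc (count R)) h ∎
  where
  open ≡-Reasoning
  H : Vec Bool _ × Vec Bool _ → ℕ
  H (R₁ , R₂) = h (count R₁) (count R₂)
∑-splits (false ∷ R) h = trans (∑-map consᵒ (splits R) _) (∑-splits R h)

count-split : ∀ (R R₁ R₂ : Vec Bool n) → Split R R₁ R₂ → count R ≡ count R₁ + count R₂
count-split [] [] [] s = refl
count-split (x ∷ R) (y ∷ R₁) (z ∷ R₂) s with x | y | z | s zero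
... | _ | _ | _ | left = cong suc (count-split R R₁ R₂ (s ∘ suc))
... | _ | _ | _ | right = trans (cong suc (count-split R R₁ R₂ (s ∘ suc))) (sym (ℕ.+-suc (count R₁) (count R₂)))
... | _ | _ | _ | out = count-split R R₁ R₂ (s ∘ suc)

fromEntries : (Fin m → Fin n → Fin q) → Matrix q m n
fromEntries f = Vec.tabulate λ i → Vec.tabulate (f i)

at-fromEntries : ∀ (f : Fin m → Fin n → Fin q) i j → at (fromEntries f) i j ≡ f i j
at-fromEntries f i j = trans (cong (λ v → lookup v j) (Vec.lookup∘tabulate _ i)) (Vec.lookup∘tabulate (f i) j)

at-ext : {M N : Matrix q m n} → (∀ i j → at M i j ≡ at N i j) → M ≡ N
at-ext eq = lookup-ext λ i → lookup-ext (eq i)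

-- Rows of R₁ carry free data over K₁ only: over K₂ unswitchability forces q - 1, and outside K
-- there is nothing but zeros.
entry : (inR₁ inK₁ inK₂ : Bool) → Fin (suc q) → Fin (suc q) → Fin (suc q)
entry true true _ x y = x
entry true false true x y = fromℕ _
entry true false false x y = zero
entry false _ _ x y = y

glue : Vec Bool m → Vec Bool n → Vec Bool n → Matrix (suc q) m n → Matrix (suc q) m n → Matrix (suc q) m n
glue R₁ K₁ K₂ X N =
  fromEntries λ i j → entry (lookup R₁ i) (lookup K₁ j) (lookup K₂ j) (at X i j) (at N i j)

-- R₁ is the set of full rows of the glued matrix, and K₁ that of the columns
-- vanishing outside R₁.
record Peel (R : Vec Bool m) (K : Vec Bool n) (R₁ R₂ : Vec Bool m) (K₁ K₂ : Vec Bool n)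
    (X N : Matrix (suc (suc p)) m n) : Set where
  constructor peel
  field
    rows     : Split R R₁ R₂
    cols     : Split K K₁ K₂
    nonEmptyRows : NonEmpty R₁
    nonEmptyCols : NonEmpty K₁
    block    : Block R₁ K₁ X
    midLine  : MidLine X
    hull     : Hull R₂ K₂ N

module Peeled {R : Vec Bool m} {K : Vec Bool n} {R₁ R₂ K₁ K₂} {X N : Matrix (suc (suc p)) m n}
  (P : Peel R K R₁ R₂ K₁ K₂ X N) where
  open Peel P public

  M : Matrix (suc (suc p)) m n
  M = glue R₁ K₁ K₂ X N

  entry≡ : ∀ i j → at M i j ≡ entry (lookup R₁ i) (lookup K₁ j) (lookup K₂ j) (at X i j) (at N i j)
  entry≡ = at-fromEntries _

  inner : ∀ i j → lookup R₁ i ≡ true → lookup K₁ j ≡ true → at M i j ≡ at X i j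
  inner i j r k rewrite entry≡ i j | r | k = refl

  corner : ∀ i j → lookup R₁ i ≡ true → lookup K₂ j ≡ true → at M i j ≡ fromℕ (suc p)
  corner i j r k rewrite entry≡ i j | r | k | ≢true⇒≡false (λ k₁ → part-disjoint (cols j) k₁ k) = refl

  rest : ∀ i j → lookup R₁ i ≡ false → at M i j ≡ at N i j
  rest i j r rewrite entry≡ i j | r = refl

  outer : ∀ i j → lookup R₁ i ≡ true → pos (at M i j) ≡ true → lookup K j ≡ true
  outer i j r t rewrite entry≡ i j | r with lookup K j | lookup K₁ j | lookup K₂ j | cols j
  ... | _ | _ | _ | left = refl
  ... | _ | _ | _ | right = refl

  R₂⇒¬R₁ : ∀ i → lookup R₂ i ≡ true → lookup R₁ i ≡ false
  R₂⇒¬R₁ i r = ≢true⇒≡false λ r₁ → part-disjoint (rows i) r₁ r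

  X-pos : ∀ i j → lookup R₁ i ≡ true → lookup K₁ j ≡ true → pos (at X i j) ≡ true
  X-pos i j r k = trans (block i j) (cong₂ _∧_ r k)

  full : ∀ i j → lookup R₁ i ≡ true → lookup K j ≡ true → pos (at M i j) ≡ true
  full i j r k with part-cover (cols j) k
  ... | inj₁ k₁ = trans (cong pos (inner i j r k₁)) (X-pos i j r k₁)
  ... | inj₂ k₂ = cong pos (corner i j r k₂)

  rest-col : ∀ i j → lookup R₁ i ≡ false → pos (at M i j) ≡ true → lookup K₂ j ≡ true
  rest-col i j r t = inCol hull i j (trans (cong pos (sym (rest i j r))) t)

  -- A remaining row vanishes on all of K₁. As K₁ is nonempty, this separates R₂ from the full rows,
  -- which makes the peel unique.
  notFull : ∀ i j → lookup R₂ i ≡ true → lookup K₁ j ≡ true → pos (at M i j) ≡ true → ⊥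
  notFull i j r k t = part-disjoint (cols j) k (rest-col i j (R₂⇒¬R₁ i r) t)

  corner-top : ∀ i j → lookup R₁ i ≡ true → lookup K₂ j ≡ true → isTop (at M i j) ≡ false → ⊥
  corner-top i j r k eq =
    true≢false (trans (cong isTop (corner i j r k)) (isTop-fromℕ (suc p))) eq

  inner-mid : ∀ i j → lookup R₁ i ≡ true → lookup K j ≡ true → isTop (at M i j) ≡ false →
    mid (at X i j) ≡ true
  inner-mid i j r k eq with part-cover (cols j) k
  ... | inj₁ k₁ = pos∧isTop≡false⇒mid (at X i j) (X-pos i j r k₁) (trans (cong isTop (sym (inner i j r k₁))) eq)
  ... | inj₂ k₂ = ⊥-elim (corner-top i j r k₂ eq)

  glued-hull : Hull R K M
  glued-hull .unswitchable i i′ j j′ t e t′ e′ i≢ j≢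
    with true∨false (lookup R₁ i) | true∨false (lookup R₁ i′)
  -- Within R₁ the raised entries are below q - 1, so they avoid the columns of K₂ and are two mid
  -- entries of the block.
  ... | inj₁ r | inj₁ r′ =
    midLine i i′ j j′ (inner-mid i j r (outer i′ j r′ e′) t) (inner-mid i′ j′ r′ (outer i j′ r e) t′) i≢ j≢
  -- Row `i′` lies outside R₁ and is positive in column `j`, so `j` is in K₂, where row `i` is
  -- already at q - 1.
  ... | inj₁ r | inj₂ r′ = corner-top i j r (rest-col i′ j r′ e′) t
  ... | inj₂ r | inj₁ r′ = corner-top i′ j′ r′ (rest-col i j′ r e) t′
  ... | inj₂ r | inj₂ r′ = hull .unswitchable i i′ j j′
    (trans (cong isTop (sym (rest i j r))) t) (trans (cong pos (sym (rest i j′ r))) e)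
    (trans (cong isTop (sym (rest i′ j′ r′))) t′) (trans (cong pos (sym (rest i′ j r′))) e′) i≢ j≢
  glued-hull .inRow i j t with true∨false (lookup R₁ i)
  ... | inj₁ r = part-left (rows i) r
  ... | inj₂ r = part-right (rows i) (hull .inRow i j (trans (cong pos (sym (rest i j r))) t))
  glued-hull .inCol i j t with true∨false (lookup R₁ i)
  ... | inj₁ r = outer i j r t
  ... | inj₂ r = part-right (cols j) (rest-col i j r t)
  glued-hull .rowHit i r with part-cover (rows i) r
  ... | inj₁ r₁ = let j , k = nonEmptyCols in j , full i j r₁ (part-left (cols j) k)
  ... | inj₂ r₂ = let j , t = hull .rowHit i r₂ in j , trans (cong pos (rest i j (R₂⇒¬R₁ i r₂))) t
  glued-hull .colHit j k = let i , r = nonEmptyRows in i , full i j r k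

module _ {R : Vec Bool m} {K : Vec Bool n} where
  -- A row of R₁ is positive on all of K, whereas a row of R₂′ vanishes on the nonempty set K₁′.
  rows-⊆ : ∀ {R₁ R₂ K₁ K₂ R₁′ R₂′ K₁′ K₂′} {X N X′ N′ : Matrix (suc (suc p)) m n} →
    Peel R K R₁ R₂ K₁ K₂ X N → Peel R K R₁′ R₂′ K₁′ K₂′ X′ N′ →
    glue R₁ K₁ K₂ X N ≡ glue R₁′ K₁′ K₂′ X′ N′ → ∀ i → lookup R₁ i ≡ true → lookup R₁′ i ≡ true
  rows-⊆ {R₂′ = R₂′} P P′ eq i r = [ id , (λ r₂ → ⊥-elim (notPos r₂)) ]′ (part-cover (P′.rows i) (part-left (P.rows i) r))
    where
    module P = Peeled P
    module P′ = Peeled P′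
    notPos : lookup R₂′ i ≡ true → ⊥
    notPos r₂ = let j , k = P′.nonEmptyCols in
      P′.notFull i j r₂ k (trans (cong (λ M → pos (at M i j)) (sym eq)) (P.full i j r (part-left (P′.cols j) k)))

  -- With the row parts known to agree, K₂ can be read off the matrix: its columns are those with a
  -- positive entry outside R₁.
  cols-⊆ : ∀ {R₁ R₂ K₁ K₂ K₁′ K₂′} {X N X′ N′ : Matrix (suc (suc p)) m n} →
    Peel R K R₁ R₂ K₁ K₂ X N → Peel R K R₁ R₂ K₁′ K₂′ X′ N′ →
    glue R₁ K₁ K₂ X N ≡ glue R₁ K₁′ K₂′ X′ N′ → ∀ j → lookup K₂ j ≡ true → lookup K₂′ j ≡ true
  cols-⊆ P P′ eq j k =
    let i , t = P.hull .colHit j k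
        r = P.R₂⇒¬R₁ i (P.hull .inRow i j t)
    in P′.rest-col i j r (trans (cong (λ M → pos (at M i j)) (sym eq)) (trans (cong pos (P.rest i j r)) t))
    where
    module P = Peeled P
    module P′ = Peeled P′

  -- Both `X` and `N` vanish where the glued matrix does not show them.
  parts-≡ : ∀ {R₁ R₂ K₁ K₂} {X N X′ N′ : Matrix (suc (suc p)) m n} →
    Peel R K R₁ R₂ K₁ K₂ X N → Peel R K R₁ R₂ K₁ K₂ X′ N′ →
    glue R₁ K₁ K₂ X N ≡ glue R₁ K₁ K₂ X′ N′ → X ≡ X′ × N ≡ N′
  parts-≡ {R₁ = R₁} {K₁ = K₁} {X = X} {N} {X′} {N′} P P′ eq = at-ext X≡ , at-ext N≡
    where
    module P = Peeled P
    module P′ = Peeled P′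
    eqAt : ∀ i j → at P.M i j ≡ at P′.M i j
    eqAt i j = cong (λ M → at M i j) eq
    zero-zero : ∀ {x y : Fin (suc (suc p))} → pos x ≡ false → pos y ≡ false → x ≡ y
    zero-zero e e′ = trans (pos≡false⇒≡zero _ e) (sym (pos≡false⇒≡zero _ e′))
    X≡ : ∀ i j → at X i j ≡ at X′ i j
    X≡ i j with true∨false (lookup R₁ i) | true∨false (lookup K₁ j)
    ... | inj₁ r | inj₁ k = trans (sym (P.inner i j r k)) (trans (eqAt i j) (P′.inner i j r k))
    ... | inj₁ r | inj₂ k = zero-zero (trans (P.block i j) (cong₂ _∧_ r k)) (trans (P′.block i j) (cong₂ _∧_ r k))
    ... | inj₂ r | _ = zero-zero (trans (P.block i j) (cong (_∧ lookup K₁ j) r))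
                                 (trans (P′.block i j) (cong (_∧ lookup K₁ j) r))
    N≡ : ∀ i j → at N i j ≡ at N′ i j
    N≡ i j with true∨false (lookup R₁ i)
    ... | inj₁ r = zero-zero
      (≢true⇒≡false λ t → part-disjoint (P.rows i) r (P.hull .inRow i j t))
      (≢true⇒≡false λ t → part-disjoint (P′.rows i) r (P′.hull .inRow i j t))
    ... | inj₂ r = trans (sym (P.rest i j r)) (trans (eqAt i j) (P′.rest i j r))

-- Existence of the peel

comprehension : ∀ {P : Fin n → Set} → Decidable P →
  Σ (Vec Bool n) λ b → ∀ i → (lookup b i ≡ true → P i) × (P i → lookup b i ≡ true)
comprehension {zero} P? = [] , λ ()
comprehension {suc n} P? with P? zero | comprehension (P? ∘ suc)
... | yes p | b , f = true ∷ b , λ { zero → (λ _ → p) , (λ _ → refl) ; (suc i) → f i }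
... | no ¬p | b , f = false ∷ b , λ { zero → (λ ()) , (λ p → contradiction p ¬p) ; (suc i) → f i }

greatest : ∀ (_≼_ : Fin n → Fin n → Set) → (∀ x y → x ≼ y ⊎ y ≼ x) →
  (∀ {x y z} → x ≼ y → y ≼ z → x ≼ z) → Fin n → ∃ λ x → ∀ y → y ≼ x
greatest {suc zero} _≼_ total tr _ = zero , λ { zero → [ id , id ]′ (total zero zero) }
greatest {suc (suc n)} _≼_ total tr _
  with greatest (λ x y → suc x ≼ suc y) (λ x y → total (suc x) (suc y)) tr zero
... | x , max with total zero (suc x)
... | inj₁ le = suc x , λ { zero → le ; (suc y) → max y }
... | inj₂ ge = zero , λ { zero → [ id , id ]′ (total zero zero) ; (suc y) → tr (max y) ge }

Nested : Matrix q m n → Fin m → Fin m → Set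
Nested M i i′ = ∀ j → pos (at M i j) ≡ true → pos (at M i′ j) ≡ true

¬pos⇒¬isTop : (x : Fin (suc (suc p))) → pos x ≡ false → isTop x ≡ false
¬pos⇒¬isTop zero _ = refl

module Unpeel {R : Vec Bool m} {K : Vec Bool n} {M : Matrix (suc (suc p)) m n} (H : Hull R K M)
  (i₀ : Fin m) (i₀∈R : lookup R i₀ ≡ true) where

  rows-differ : ∀ {i i′ j} → pos (at M i j) ≡ true → pos (at M i′ j) ≡ false → i ≢ i′
  rows-differ t f refl = true≢false t f

  cols-differ : ∀ {i j j′} → pos (at M i j) ≡ true → pos (at M i j′) ≡ false → j ≢ j′
  cols-differ t f refl = true≢false t f

  -- Two rows that are each positive where the other is zero would allow a switch, as 0 lies below q
  -- - 1 for q ≥ 2.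
  nested : ∀ i i′ → Nested M i i′ ⊎ Nested M i′ i
  nested i i′ with Fin.any? (λ j → (pos (at M i j) Bool.≟ true) ×-dec (pos (at M i′ j) Bool.≟ false))
  ... | no ∄ = inj₁ λ j t → [ id , (λ f → contradiction (j , t , f) ∄) ]′ (true∨false (pos (at M i′ j)))
  ... | yes (j , t , f) = inj₂ λ j′ t′ → [ id , (λ f′ → ⊥-elim (H .unswitchable i i′ j′ j
      (¬pos⇒¬isTop _ f′) t (¬pos⇒¬isTop _ f) t′ (rows-differ t f) (cols-differ t′ f))) ]′
    (true∨false (pos (at M i j′)))

  -- Rows outside `b` are put below all others, which makes the comparison total on all of `Fin m`;
  -- for empty `b` the row found is arbitrary and the claim vacuous.
  widest : ∀ (b : Vec Bool m) → ∃ λ x → ∀ i → lookup b i ≡ true → lookup b x ≡ true × Nested M i x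
  widest b = greatest (λ i x → lookup b i ≡ true → lookup b x ≡ true × Nested M i x) total
    (λ f g bi → let bx , le = f bi ; by , le′ = g bx in by , λ j → le′ j ∘ le j) i₀
    where
    total : ∀ i x → (lookup b i ≡ true → lookup b x ≡ true × Nested M i x) ⊎
                    (lookup b x ≡ true → lookup b i ≡ true × Nested M x i)
    total i x with true∨false (lookup b i) | true∨false (lookup b x)
    ... | inj₂ bi | _ = inj₁ λ t → ⊥-elim (true≢false t bi)
    ... | inj₁ _ | inj₂ bx = inj₂ λ t → ⊥-elim (true≢false t bx)
    ... | inj₁ bi | inj₁ bx = [ (λ le → inj₁ λ _ → bx , le) , (λ le → inj₂ λ _ → bi , le) ]′ (nested i x)

  Full Gap : Fin m → Set
  Full i = ∀ j → lookup K j ≡ true → pos (at M i j) ≡ true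
  Gap i = ∃ λ j → lookup K j ≡ true × pos (at M i j) ≡ false

  gap? : Decidable Gap
  gap? i = Fin.any? λ j → (lookup K j Bool.≟ true) ×-dec (pos (at M i j) Bool.≟ false)

  ¬gap⇒full : ∀ i → ¬ Gap i → Full i
  ¬gap⇒full i ¬gap j k = [ id , (λ f → contradiction (j , k , f) ¬gap) ]′ (true∨false (pos (at M i j)))

  rows₂ = comprehension (λ i → (lookup R i Bool.≟ true) ×-dec gap? i)
  R₂ = proj₁ rows₂
  rows₁ = comprehension (λ i → (lookup R i Bool.≟ true) ×-dec ¬? (gap? i))
  R₁ = proj₁ rows₁
  cols₂ = comprehension (λ j → Fin.any? λ i → (lookup R₂ i Bool.≟ true) ×-dec (pos (at M i j) Bool.≟ true))
  K₂ = proj₁ cols₂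
  cols₁ = comprehension (λ j → (lookup K j Bool.≟ true) ×-dec ¬? (lookup K₂ j Bool.≟ true))
  K₁ = proj₁ cols₁

  R₁⇒ : ∀ i → lookup R₁ i ≡ true → lookup R i ≡ true × ¬ Gap i
  R₁⇒ i = proj₁ (proj₂ rows₁ i)
  R₂⇒ : ∀ i → lookup R₂ i ≡ true → lookup R i ≡ true × Gap i
  R₂⇒ i = proj₁ (proj₂ rows₂ i)
  K₂⇒ : ∀ j → lookup K₂ j ≡ true → ∃ λ i → lookup R₂ i ≡ true × pos (at M i j) ≡ true
  K₂⇒ j = proj₁ (proj₂ cols₂ j)
  K₁⇒ : ∀ j → lookup K₁ j ≡ true → lookup K j ≡ true × lookup K₂ j ≢ true
  K₁⇒ j = proj₁ (proj₂ cols₁ j)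

  R₁-full : ∀ i → lookup R₁ i ≡ true → Full i
  R₁-full i r = ¬gap⇒full i (proj₂ (R₁⇒ i r))

  K₂⊆K : ∀ j → lookup K₂ j ≡ true → lookup K j ≡ true
  K₂⊆K j k = let i , _ , t = K₂⇒ j k in H .inCol i j t

  splitR : Split R R₁ R₂
  splitR i = part (proj₁ ∘ R₁⇒ i) (proj₁ ∘ R₂⇒ i) (λ r₁ r₂ → proj₂ (R₁⇒ i r₁) (proj₂ (R₂⇒ i r₂)))
    λ r → case-gap r (gap? i)
    where
    case-gap : lookup R i ≡ true → Dec (Gap i) → lookup R₁ i ≡ true ⊎ lookup R₂ i ≡ true
    case-gap r (yes g) = inj₂ (proj₂ (proj₂ rows₂ i) (r , g))
    case-gap r (no ¬g) = inj₁ (proj₂ (proj₂ rows₁ i) (r , ¬g))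

  K∖K₂⊆K₁ : ∀ j → lookup K j ≡ true → lookup K₂ j ≢ true → lookup K₁ j ≡ true
  K∖K₂⊆K₁ j k ¬k₂ = proj₂ (proj₂ cols₁ j) (k , ¬k₂)

  splitK : Split K K₁ K₂
  splitK j = part (proj₁ ∘ K₁⇒ j) (K₂⊆K j) (proj₂ ∘ K₁⇒ j)
    λ k → [ inj₂ , (λ f → inj₁ (K∖K₂⊆K₁ j k λ t → true≢false t f)) ]′ (true∨false (lookup K₂ j))

  -- Each column of K is met by some row of R, whose support the widest row contains.
  R₁-nonEmpty : NonEmpty R₁
  R₁-nonEmpty =
    let x , max = widest R
        _ , le₀ = max i₀ i₀∈R
        j₀ , t₀ = H .rowHit i₀ i₀∈R
        full : Full x
        full j k = let i , t = H .colHit j k in proj₂ (max i (H .inRow i j t)) j t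
    in x , proj₂ (proj₂ rows₁ x)
         (H .inRow x j₀ (le₀ j₀ t₀) , λ (j , k , f) → true≢false (full j k) f)

  -- A gap of a widest non-full row is a gap of every non-full row.
  K₁-nonEmpty : NonEmpty K₁
  K₁-nonEmpty with widest R₂
  ... | x , max with true∨false (lookup R₂ x)
  ...   | inj₁ r₂ =
    let j , k , f = proj₂ (R₂⇒ x r₂)
    in j , K∖K₂⊆K₁ j k λ k₂ →
         let i , r , t = K₂⇒ j k₂ in true≢false (proj₂ (max i r) j t) f
  -- The set R₂ is empty here, so K₂ is empty as well and any column of K will do.
  ...   | inj₂ ¬r₂ =
    let j₀ , t₀ = H .rowHit i₀ i₀∈R
    in j₀ , K∖K₂⊆K₁ j₀ (H .inCol i₀ j₀ t₀) λ k₂ →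
         let i , r , _ = K₂⇒ j₀ k₂ in true≢false (proj₁ (max i r)) ¬r₂

  X N : Matrix (suc (suc p)) m n
  X = fromEntries λ i j → if lookup R₁ i ∧ lookup K₁ j then at M i j else zero
  N = fromEntries λ i j → if lookup R₂ i then at M i j else zero

  X-in : ∀ i j → lookup R₁ i ≡ true → lookup K₁ j ≡ true → at X i j ≡ at M i j
  X-in i j r k rewrite at-fromEntries (λ i j → if lookup R₁ i ∧ lookup K₁ j then at M i j else zero) i j | r | k = refl

  X-out : ∀ i j → lookup R₁ i ∧ lookup K₁ j ≡ false → at X i j ≡ zero
  X-out i j e rewrite at-fromEntries (λ i j → if lookup R₁ i ∧ lookup K₁ j then at M i j else zero) i j | e = refl

  N-in : ∀ i j → lookup R₂ i ≡ true → at N i j ≡ at M i j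
  N-in i j r rewrite at-fromEntries (λ i j → if lookup R₂ i then at M i j else zero) i j | r = refl

  N-out : ∀ i j → lookup R₂ i ≡ false → at N i j ≡ zero
  N-out i j r rewrite at-fromEntries (λ i j → if lookup R₂ i then at M i j else zero) i j | r = refl

  X-block : Block R₁ K₁ X
  X-block i j with true∨false (lookup R₁ i ∧ lookup K₁ j)
  ... | inj₂ e = trans (cong pos (X-out i j e)) (sym e)
  ... | inj₁ e =
    let r = Bool.∧-conicalˡ (lookup R₁ i) (lookup K₁ j) e
        k = Bool.∧-conicalʳ (lookup R₁ i) (lookup K₁ j) e
    in trans (trans (cong pos (X-in i j r k)) (R₁-full i r j (proj₁ (K₁⇒ j k)))) (sym e)

  mid-X : ∀ i j → mid (at X i j) ≡ true →
    lookup R₁ i ≡ true × lookup K₁ j ≡ true × isTop (at M i j) ≡ false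
  mid-X i j t =
    let e = trans (sym (X-block i j)) (mid⇒pos _ t)
        r = Bool.∧-conicalˡ (lookup R₁ i) (lookup K₁ j) e
        k = Bool.∧-conicalʳ (lookup R₁ i) (lookup K₁ j) e
    in r , k , trans (cong isTop (sym (X-in i j r k))) (mid⇒isTop≡false (at X i j) t)

  -- The rows of R₁ are full, so two mid entries of `X` on different lines are the raised entries of
  -- a switch in `M`.
  X-midLine : MidLine X
  X-midLine i i′ j j′ t t′ i≢ j≢ =
    let r , k , e = mid-X i j t
        r′ , k′ , e′ = mid-X i′ j′ t′
    in H .unswitchable i i′ j j′ e (R₁-full i r j′ (proj₁ (K₁⇒ j′ k′))) e′
         (R₁-full i′ r′ j (proj₁ (K₁⇒ j k))) i≢ j≢

  N-pos : ∀ i j → pos (at N i j) ≡ true → lookup R₂ i ≡ true × pos (at M i j) ≡ true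
  N-pos i j t with true∨false (lookup R₂ i)
  ... | inj₁ r = r , trans (cong pos (sym (N-in i j r))) t
  ... | inj₂ r = ⊥-elim (true≢false t (cong pos (N-out i j r)))

  N-hull : Hull R₂ K₂ N
  N-hull .unswitchable i i′ j j′ t e t′ e′ =
    -- The two positive entries put both rows into R₂, where `N` agrees with `M`.
    let r , e₁ = N-pos i j′ e
        r′ , e₁′ = N-pos i′ j e′
    in H .unswitchable i i′ j j′ (trans (cong isTop (sym (N-in i j r))) t) e₁
         (trans (cong isTop (sym (N-in i′ j′ r′))) t′) e₁′
  N-hull .inRow i j t = proj₁ (N-pos i j t)
  N-hull .inCol i j t = let r , t′ = N-pos i j t in proj₂ (proj₂ cols₂ j) (i , r , t′)
  N-hull .rowHit i r = let j , t = H .rowHit i (proj₁ (R₂⇒ i r)) in j , trans (cong pos (N-in i j r)) t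
  N-hull .colHit j k = let i , r , t = K₂⇒ j k in i , trans (cong pos (N-in i j r)) t

  peeled : Peel R K R₁ R₂ K₁ K₂ X N
  peeled = peel splitR splitK R₁-nonEmpty K₁-nonEmpty X-block X-midLine N-hull

  -- A row of R₂ that meets column `j` has a gap in some column of K, where row `i` is positive. If
  -- the entry (i, j) were below q - 1, raising it together with the gap would give a switch.
  corner-top : ∀ i j → lookup R₁ i ≡ true → lookup K₂ j ≡ true → isTop (at M i j) ≡ true
  corner-top i j r k with true∨false (isTop (at M i j))
  ... | inj₁ t = t
  ... | inj₂ e =
    let i′ , r′ , t = K₂⇒ j k
        j′ , k′ , f = proj₂ (R₂⇒ i′ r′)
        t′ = R₁-full i r j′ k′
    in ⊥-elim (H .unswitchable i i′ j j′ e t′ (¬pos⇒¬isTop _ f) t (rows-differ t′ f) (cols-differ t f))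

  glue-peeled : M ≡ glue R₁ K₁ K₂ X N
  glue-peeled = at-ext go
    where
    open Peeled peeled using (inner; corner; rest; outer)
    G : Matrix (suc (suc p)) m n
    G = glue R₁ K₁ K₂ X N
    outside : ∀ i j → lookup K j ≢ true → lookup R₁ i ≡ true → at M i j ≡ at G i j
    outside i j ¬k r = trans (pos≡false⇒≡zero _ (≢true⇒≡false λ t → ¬k (H .inCol i j t)))
      (sym (pos≡false⇒≡zero _ (≢true⇒≡false λ t → ¬k (outer i j r t))))
    go : ∀ i j → at M i j ≡ at G i j
    go i j with true∨false (lookup R₁ i)
    ... | inj₁ r with true∨false (lookup K j)
    ...   | inj₂ ¬k = outside i j (λ t → true≢false t ¬k) r
    ...   | inj₁ k with part-cover (splitK j) k
    ...     | inj₁ k₁ = sym (trans (inner i j r k₁) (X-in i j r k₁))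
    ...     | inj₂ k₂ = trans (isTop⇒≡fromℕ _ (corner-top i j r k₂)) (sym (corner i j r k₂))
    go i j | inj₂ r with true∨false (lookup R₂ i)
    ...   | inj₁ r₂ = sym (trans (rest i j r) (N-in i j r₂))
    ...   | inj₂ ¬r₂ = trans (pos≡false⇒≡zero _ (≢true⇒≡false λ t →
                [ (λ r₁ → true≢false r₁ r) , (λ r₂ → true≢false r₂ ¬r₂) ]′ (part-cover (splitR i) (H .inRow i j t))))
              (sym (trans (rest i j r) (N-out i j ¬r₂)))

-- Counting by repeated peeling

Parts : ℕ → ℕ → ℕ → Set
Parts q m n = (Vec Bool m × Vec Bool m) × ((Vec Bool n × Vec Bool n) × (Matrix q m n × Matrix q m n))

IsPeel : Vec Bool m → Vec Bool n → Parts (suc (suc p)) m n → Set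
IsPeel R K ((R₁ , R₂) , (K₁ , K₂) , X , N) = Peel R K R₁ R₂ K₁ K₂ X N

gluing : Parts (suc (suc p)) m n → Matrix (suc (suc p)) m n
gluing ((R₁ , R₂) , (K₁ , K₂) , X , N) = glue R₁ K₁ K₂ X N

-- The order of recovery matters: K₂ is recognised as the set of columns met outside R₁, so the row
-- parts come first.
gluing-injective : ∀ {R : Vec Bool m} {K : Vec Bool n} {s t : Parts (suc (suc p)) m n} →
  IsPeel R K s → IsPeel R K t → gluing s ≡ gluing t → s ≡ t
gluing-injective {s = (R₁ , R₂) , (K₁ , K₂) , _} {(R₁′ , R₂′) , (K₁′ , K₂′) , _} P P′ eq
  with lookup-ext {v = R₁} {R₁′} (λ i → true-antisym (rows-⊆ P P′ eq i) (rows-⊆ P′ P (sym eq) i))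
... | refl with lookup-ext {v = R₂} {R₂′} (λ i → part-uniqueʳ (Peel.rows P i) (Peel.rows P′ i))
... | refl with lookup-ext {v = K₂} {K₂′} (λ j → true-antisym (cols-⊆ P P′ eq j) (cols-⊆ P′ P (sym eq) j))
... | refl with lookup-ext {v = K₁} {K₁′} (λ j → part-uniqueˡ (Peel.cols P j) (Peel.cols P′ j))
... | refl with parts-≡ P P′ eq
... | refl , refl = refl

-- With no rows left there can be no columns left, since every column of K has to be met; only the
-- zero matrix remains.
card-emptyHull : (R : Vec Bool m) (K : Vec Bool n) →
  Card {Matrix (suc (suc p)) m n} (λ M → Hull R K M × count R ≡ 0) (isZero (count R) * isZero (count K))
card-emptyHull {m} {n} {p} R K = go (count R) refl (count K) refl
  where
  zeroMatrix : Matrix (suc (suc p)) m n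
  zeroMatrix = fromEntries λ _ _ → zero
  notPos : ∀ {i j} → pos (at zeroMatrix i j) ≡ true → ⊥
  notPos {i} {j} t = true≢false t (cong pos (at-fromEntries (λ _ _ → zero) i j))
  go : ∀ r → count R ≡ r → ∀ c → count K ≡ c →
    Card {Matrix (suc (suc p)) m n} (λ M → Hull R K M × count R ≡ 0) (isZero r * isZero c)
  go (suc r) eq c _ = card-empty λ (_ , eq′) → contradiction (trans (sym eq) eq′) λ ()
  go zero eq (suc c) eq′ = card-empty λ (H , _) →
    let j , k = count≥1⇒∃true K (subst (1 ≤_) (sym eq′) (s≤s z≤n))
        i , t = H .colHit j k
    in true≢false (H .inRow i j t) (count≡0⇒false R eq i)
  go zero eq zero eq′ = card-cong
    (λ { refl → record
      { unswitchable = λ _ _ _ _ _ t → ⊥-elim (notPos t)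
      ; inRow = λ _ _ t → ⊥-elim (notPos t)
      ; inCol = λ _ _ t → ⊥-elim (notPos t)
      ; rowHit = λ i r → ⊥-elim (true≢false r (count≡0⇒false R eq i))
      ; colHit = λ j k → ⊥-elim (true≢false k (count≡0⇒false K eq′ j))
      } , eq })
    (λ (H , _) → at-ext λ i j → trans
      (pos≡false⇒≡zero _ (≢true⇒≡false λ t → true≢false (H .inRow i j t) (count≡0⇒false R eq i)))
      (sym (at-fromEntries (λ _ _ → zero) i j)))
    (card-single zeroMatrix)

count-right< : ∀ (R R₁ R₂ : Vec Bool n) → Split R R₁ R₂ → NonEmpty R₁ → count R₂ < count R
count-right< R R₁ R₂ s (i , t) =
  subst (count R₂ <_) (sym (count-split R R₁ R₂ s)) (ℕ.m<n+m (count R₂) (∃true⇒count≥1 R₁ t))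

-- Induction on the bound `f`: a peel removes at least one row and one column, so the smaller of the
-- two counts drops strictly.
card-hull : ∀ f (R : Vec Bool m) (K : Vec Bool n) → count R ⊓ count K < f →
  Card {Matrix (suc (suc p)) m n} (Hull R K) (chainTotal (suc (suc p)) f (count R) (count K))
card-hull {m} {n} {p} (suc f) R K (s≤s le) = subst (Card (Hull R K)) (sym total) (card-cong
    (λ { (inj₁ (H , _)) → H ; (inj₂ (t , P , refl)) → Peeled.glued-hull P })
    from
    (card-⊎ (λ { (_ , eq) (((R₁ , R₂) , _) , P , _) → empty R₁ R₂ eq (Peel.rows P) (Peel.nonEmptyRows P) })
      (card-emptyHull R K)
      (card-image gluing gluing-injective cardParts)))
  where
  q′ : ℕ
  q′ = suc (suc p)
  empty : ∀ R₁ R₂ → count R ≡ 0 → Split R R₁ R₂ → NonEmpty R₁ → ⊥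
  empty R₁ R₂ eq s (i , t) = true≢false (part-left (s i) t) (count≡0⇒false R eq i)
  from : ∀ {M : Matrix q′ m n} → Hull R K M →
    (Hull R K M × count R ≡ 0) ⊎ (∃ λ t → IsPeel R K t × M ≡ gluing t)
  from H with count R ℕ.≟ 0
  ... | yes eq = inj₁ (H , eq)
  ... | no ≢0 =
    let i₀ , r = count≥1⇒∃true R (ℕ.n≢0⇒n>0 ≢0)
        open Unpeel H i₀ r
    in inj₂ (((R₁ , R₂) , (K₁ , K₂) , X , N) , peeled , glue-peeled)
  smaller : ∀ R₁ R₂ K₁ K₂ → Split R R₁ R₂ → Split K K₁ K₂ → NonEmpty R₁ → NonEmpty K₁ →
    Card {Matrix q′ m n} (Hull R₂ K₂) (chainTotal q′ f (count R₂) (count K₂))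
  smaller R₁ R₂ K₁ K₂ s s′ r k = card-hull f R₂ K₂
    (ℕ.<-≤-trans (ℕ.⊓-mono-< (count-right< R R₁ R₂ s r) (count-right< K K₁ K₂ s′ k)) le)
  weight : Vec Bool m × Vec Bool m → Vec Bool n × Vec Bool n → ℕ
  weight (R₁ , R₂) (K₁ , K₂) =
    properBlock q′ (count R₁) (count K₁) * chainTotal q′ f (count R₂) (count K₂)
  cardParts : Card (IsPeel R K) (∑ (splits R) λ s → ∑ (splits K) (weight s))
  cardParts = card-cong
    (λ { (s , s′ , (r , k , B , L) , H) → peel s s′ r k B L H })
    (λ { (peel s s′ r k B L H) → s , s′ , (r , k , B , L) , H })
    (card-Σ (enum-splits R) λ (R₁ , R₂) s → card-Σ (enum-splits K) λ (K₁ , K₂) s′ →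
      card-× (card-properBlock R₁ K₁) λ (r , k , _) → smaller R₁ R₂ K₁ K₂ s s′ r k)
  total : chainTotal q′ (suc f) (count R) (count K) ≡
    isZero (count R) * isZero (count K) + ∑ (splits R) λ s → ∑ (splits K) (weight s)
  total = trans (chainTotal-suc q′ f (count R) (count K))
    (cong (isZero (count R) * isZero (count K) +_) (sym (trans
      (∑-cong (splits R) λ (R₁ , R₂) → ∑-splits K λ c₁ c₂ →
        properBlock q′ (count R₁) c₁ * chainTotal q′ f (count R₂) c₂)
      (∑-splits R λ r₁ r₂ → ∑₂ (count K) λ c₁ c₂ →
        properBlock q′ r₁ c₁ * chainTotal q′ f r₂ c₂))))

-- Restoring the zero rows and columns

everything : ∀ n → Vec Bool n
everything n = Vec.replicate n true

count-everything : ∀ n → count (everything n) ≡ n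
count-everything zero = refl
count-everything (suc n) = cong suc (count-everything n)

count≤ : (b : Vec Bool n) → count b ≤ n
count≤ [] = z≤n
count≤ (true ∷ b) = s≤s (count≤ b)
count≤ (false ∷ b) = ℕ.m≤n⇒m≤1+n (count≤ b)

complement : ∀ (b : Vec Bool n) → ∃ λ b′ → Split (everything n) b′ b
complement [] = [] , λ ()
complement (true ∷ b) = let b′ , s = complement b in false ∷ b′ , λ { zero → right ; (suc i) → s i }
complement (false ∷ b) = let b′ , s = complement b in true ∷ b′ , λ { zero → left ; (suc i) → s i }

hull-of : (M : Matrix q m n) → Unswitchable M → ∃₂ λ R K → Hull R K M
hull-of M U =
  let R , r = comprehension (λ i → Fin.any? λ j → pos (at M i j) Bool.≟ true)
      K , k = comprehension (λ j → Fin.any? λ i → pos (at M i j) Bool.≟ true)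
  in R , K , record
    { unswitchable = U
    ; inRow = λ i j t → proj₂ (r i) (j , t)
    ; inCol = λ i j t → proj₂ (k j) (i , t)
    ; rowHit = λ i → proj₁ (r i)
    ; colHit = λ j → proj₁ (k j)
    }

hull-unique : ∀ {R R′ : Vec Bool m} {K K′ : Vec Bool n} {M : Matrix q m n} →
  Hull R K M → Hull R′ K′ M → R ≡ R′ × K ≡ K′
hull-unique H H′ =
  lookup-ext (λ i → true-antisym (row H H′ i) (row H′ H i)) ,
  lookup-ext (λ j → true-antisym (col H H′ j) (col H′ H j))
  where
  row : ∀ {R R′ : Vec Bool m} {K K′ : Vec Bool n} {M : Matrix q m n} →
    Hull R K M → Hull R′ K′ M → ∀ i → lookup R i ≡ true → lookup R′ i ≡ true
  row H H′ i r = let j , t = H .rowHit i r in H′ .inRow i j t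
  col : ∀ {R R′ : Vec Bool m} {K K′ : Vec Bool n} {M : Matrix q m n} →
    Hull R K M → Hull R′ K′ M → ∀ j → lookup K j ≡ true → lookup K′ j ≡ true
  col H H′ j k = let i , t = H .colHit j k in H′ .inCol i j t

-- The complements R₀ and K₀ are determined by the hull; they are carried along so that `∑-splits`
-- turns the sum over hulls into the outer `∑₂ m` and `∑₂ n` of the formula.
card-unswitchable : ∀ p m n →
  Card {Matrix (suc (suc p)) m n} Unswitchable (lonesumCount (suc (suc p)) m n)
card-unswitchable p m n = card-cong
    (λ { (t , (_ , _ , H) , refl) → H .unswitchable })
    from
    (card-image matrix inj (subst (Card Located) total cardLocated))
  where
  q′ : ℕ
  q′ = suc (suc p)
  Triple : Set
  Triple = (Vec Bool m × Vec Bool m) × ((Vec Bool n × Vec Bool n) × Matrix q′ m n)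
  Located : Triple → Set
  Located ((R₀ , R) , (K₀ , K) , M) = Split (everything m) R₀ R × Split (everything n) K₀ K × Hull R K M
  matrix : Triple → Matrix q′ m n
  matrix (_ , _ , M) = M
  -- The terms j = 0, ..., min(m, n) are `suc (m ⊓ n)` in number, the same bound as in
  -- `lonesumCount≡`.
  f : ℕ
  f = suc (m ⊓ n)
  weight : Vec Bool m × Vec Bool m → Vec Bool n × Vec Bool n → ℕ
  weight (_ , R) (_ , K) = chainTotal q′ f (count R) (count K)
  cardLocated : Card Located (∑ (splits (everything m)) λ s → ∑ (splits (everything n)) (weight s))
  cardLocated = card-Σ (enum-splits (everything m)) λ (_ , R) _ → card-Σ (enum-splits (everything n)) λ (_ , K) _ →
    card-hull f R K (s≤s (ℕ.⊓-mono-≤ (count≤ R) (count≤ K)))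
  total : (∑ (splits (everything m)) λ s → ∑ (splits (everything n)) (weight s)) ≡ lonesumCount q′ m n
  total = begin
    ∑ (splits (everything m)) (λ s → ∑ (splits (everything n)) (weight s))
      ≡⟨ ∑-cong (splits (everything m)) (λ (_ , R) → ∑-splits (everything n) λ _ c → chainTotal q′ f (count R) c) ⟩
    ∑ (splits (everything m)) (λ (_ , R) → ∑₂ (count (everything n)) λ _ c → chainTotal q′ f (count R) c)
      ≡⟨ ∑-splits (everything m) (λ _ r → ∑₂ (count (everything n)) λ _ c → chainTotal q′ f r c) ⟩
    ∑₂ (count (everything m)) (λ _ r → ∑₂ (count (everything n)) λ _ c → chainTotal q′ f r c)
      ≡⟨ cong₂ (λ k l → ∑₂ k λ _ r → ∑₂ l λ _ c → chainTotal q′ f r c) (count-everything m) (count-everything n) ⟩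
    ∑₂ m (λ _ r → ∑₂ n λ _ c → chainTotal q′ f r c)
      ≡⟨ lonesumCount≡ q′ m n ⟨
    lonesumCount q′ m n ∎
    where open ≡-Reasoning
  inj : ∀ {s t} → Located s → Located t → matrix s ≡ matrix t → s ≡ t
  inj {(R₀ , _) , (K₀ , _) , _} {(R₀′ , _) , (K₀′ , _) , _} (s , s′ , H) (t , t′ , H′) refl with hull-unique H H′
  ... | refl , refl with lookup-ext {v = R₀} {R₀′} (λ i → part-uniqueˡ (s i) (t i))
                       | lookup-ext {v = K₀} {K₀′} (λ j → part-uniqueˡ (s′ j) (t′ j))
  ... | refl | refl = refl
  from : ∀ {M} → Unswitchable M → ∃ λ t → Located t × M ≡ matrix t
  from {M} U =
    let R , K , H = hull-of M U
        R₀ , s = complement R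
        K₀ , s′ = complement K
    in ((R₀ , R) , (K₀ , K) , M) , (s , s′ , H) , refl

-- Lonesum matrices are the unswitchable ones

σ : (Fin n → ℕ) → ℕ
σ f = Vec.sum (Vec.tabulate f)

σ-cong : ∀ {f g : Fin n → ℕ} → (∀ k → f k ≡ g k) → σ f ≡ σ g
σ-cong eq = cong Vec.sum (Vec.tabulate-cong eq)

sum-map≡σ : ∀ (f : A → ℕ) (v : Vec A n) → Vec.sum (Vec.map f v) ≡ σ (f ∘ lookup v)
sum-map≡σ f [] = refl
sum-map≡σ f (x ∷ v) = cong (f x +_) (sum-map≡σ f v)

σ-bump : ∀ {f g : Fin n → ℕ} j → f j ≡ suc (g j) → (∀ k → k ≢ j → f k ≡ g k) → σ f ≡ suc (σ g)
σ-bump zero eq same = cong₂ _+_ eq (σ-cong λ k → same (suc k) λ ())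
σ-bump {f = f} {g} (suc j) eq same =
  trans (cong₂ _+_ (same zero λ ()) (σ-bump j eq λ k k≢j → same (suc k) (k≢j ∘ Fin.suc-injective)))
    (ℕ.+-suc (g zero) _)

σ-switch : ∀ {f g : Fin n → ℕ} {j j′} → j ≢ j′ → f j ≡ suc (g j) → g j′ ≡ suc (f j′) →
  (∀ k → k ≢ j → k ≢ j′ → f k ≡ g k) → σ f ≡ σ g
σ-switch {f = f} {g} {j} {j′} j≢j′ up down same =
  ℕ.suc-injective (trans (sym (σ-bump j′ (h-at refl) h-f)) (σ-bump j h-j h-g))
  where
  h : Fin _ → ℕ
  h k = if does (k Fin.≟ j′) then suc (f j′) else f k
  h-at : ∀ {k} → k ≡ j′ → h k ≡ suc (f j′)
  h-at {k} eq with k Fin.≟ j′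
  ... | yes _ = refl
  ... | no ≢ = contradiction eq ≢
  h-f : ∀ k → k ≢ j′ → h k ≡ f k
  h-f k ≢ with k Fin.≟ j′
  ... | yes eq = contradiction eq ≢
  ... | no _ = refl
  h-j : h j ≡ suc (g j)
  h-j = trans (h-f j j≢j′) up
  h-g : ∀ k → k ≢ j → h k ≡ g k
  h-g k k≢j with k Fin.≟ j′
  ... | yes refl = sym down
  ... | no ≢ = same k k≢j ≢

σ-mono-≤ : ∀ {f g : Fin n → ℕ} → (∀ k → f k ≤ g k) → σ f ≤ σ g
σ-mono-≤ {zero} le = z≤n
σ-mono-≤ {suc n} le = ℕ.+-mono-≤ (le zero) (σ-mono-≤ (le ∘ suc))

σ-mono-< : ∀ {f g : Fin n → ℕ} → (∀ k → f k ≤ g k) → ∀ k → f k < g k → σ f < σ g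
σ-mono-< le zero lt = ℕ.+-mono-<-≤ lt (σ-mono-≤ (le ∘ suc))
σ-mono-< le (suc k) lt = ℕ.+-mono-≤-< (le zero) (σ-mono-< (le ∘ suc) k lt)

-- A deficit at one place must be made up at another; each step of the walk below uses this, once in
-- a column and once in a row.
σ-balance : ∀ {f g : Fin n → ℕ} → σ f ≡ σ g → ∀ k → f k < g k → ∃ λ k′ → g k′ < f k′
σ-balance {f = f} {g} eq k lt with Fin.any? (λ k′ → g k′ ℕ.<? f k′)
... | yes found = found
... | no ∄ = contradiction eq (ℕ.<⇒≢ (σ-mono-< (λ k′ → ℕ.≮⇒≥ λ gt → ∄ (k′ , gt)) k lt))

rowSum colSum : Matrix q m n → _ → ℕ
rowSum M i = σ λ j → toℕ (at M i j)
colSum M j = σ λ i → toℕ (at M i j)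

lookup-rowSums : ∀ (M : Matrix q m n) i → lookup (rowSums M) i ≡ rowSum M i
lookup-rowSums M i = trans (Vec.lookup-map i _ M) (sum-map≡σ toℕ (lookup M i))

lookup-colSums : ∀ (M : Matrix q m n) j → lookup (colSums M) j ≡ colSum M j
lookup-colSums M j = trans (Vec.lookup∘tabulate _ j) (sum-map≡σ (λ r → toℕ (lookup r j)) M)

increment : (x : Fin (suc q)) → isTop x ≡ false → ∃ λ (y : Fin (suc q)) → toℕ y ≡ suc (toℕ x)
increment x e with inject₁-preimage x e
... | y , refl = suc y , cong suc (sym (Fin.toℕ-inject₁ y))

decrement : (x : Fin (suc q)) → pos x ≡ true → ∃ λ (y : Fin (suc q)) → toℕ x ≡ suc (toℕ y)
decrement (suc x) _ = inject₁ x , cong suc (sym (Fin.toℕ-inject₁ x))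

<⇒¬isTop : ∀ {x y : Fin (suc q)} → toℕ x < toℕ y → isTop x ≡ false
<⇒¬isTop {x = x} {y} lt = ≢true⇒≡false λ t →
  ℕ.<⇒≱ lt (subst (λ z → toℕ y ≤ toℕ z) (sym (isTop⇒≡fromℕ x t)) (Fin.≤fromℕ y))

<⇒pos : ∀ {x : Fin q} {k} → k < toℕ x → pos x ≡ true
<⇒pos {x = suc x} _ = refl

twoPoints : (k k′ : Fin n) (x x′ : A) → (Fin n → A) → Fin n → A
twoPoints k k′ x x′ v l with l Fin.≟ k | l Fin.≟ k′
... | yes _ | _ = x
... | no _ | yes _ = x′
... | no _ | no _ = v l

twoPoints-fst : ∀ (k k′ : Fin n) (x x′ : A) v → twoPoints k k′ x x′ v k ≡ x
twoPoints-fst k k′ x x′ v with k Fin.≟ k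
... | yes _ = refl
... | no ≢ = contradiction refl ≢

twoPoints-snd : ∀ (k k′ : Fin n) (x x′ : A) v → k ≢ k′ → twoPoints k k′ x x′ v k′ ≡ x′
twoPoints-snd k k′ x x′ v k≢k′ with k′ Fin.≟ k | k′ Fin.≟ k′
... | yes eq | _ = contradiction (sym eq) k≢k′
... | no _ | yes _ = refl
... | no _ | no ≢ = contradiction refl ≢

twoPoints-other : ∀ (k k′ : Fin n) (x x′ : A) v l → l ≢ k → l ≢ k′ → twoPoints k k′ x x′ v l ≡ v l
twoPoints-other k k′ x x′ v l ≢k ≢k′ with l Fin.≟ k | l Fin.≟ k′
... | yes eq | _ = contradiction eq ≢k
... | no _ | yes eq = contradiction eq ≢k′
... | no _ | no _ = refl

module Switch (M : Matrix (suc q) m n) {i i′ j j′}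
  (t : isTop (at M i j) ≡ false) (e : pos (at M i j′) ≡ true)
  (t′ : isTop (at M i′ j′) ≡ false) (e′ : pos (at M i′ j) ≡ true)
  (i≢i′ : i ≢ i′) (j≢j′ : j ≢ j′) where

  up₁ up₂ down₁ down₂ : Fin (suc q)
  up₁ = proj₁ (increment (at M i j) t)
  down₁ = proj₁ (decrement (at M i j′) e)
  up₂ = proj₁ (increment (at M i′ j′) t′)
  down₂ = proj₁ (decrement (at M i′ j) e′)

  switchedRow : Fin m → Fin n → Fin (suc q)
  switchedRow a with a Fin.≟ i | a Fin.≟ i′
  ... | yes _ | _ = twoPoints j j′ up₁ down₁ (at M i)
  -- Row `i′` moves in the opposite direction, whence the exchanged columns: the raised position is
  -- always given first.
  ... | no _ | yes _ = twoPoints j′ j up₂ down₂ (at M i′)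
  ... | no _ | no _ = at M a

  row-i : ∀ c → switchedRow i c ≡ twoPoints j j′ up₁ down₁ (at M i) c
  row-i c with i Fin.≟ i
  ... | yes _ = refl
  ... | no ≢ = contradiction refl ≢

  row-i′ : ∀ c → switchedRow i′ c ≡ twoPoints j′ j up₂ down₂ (at M i′) c
  row-i′ c with i′ Fin.≟ i | i′ Fin.≟ i′
  ... | yes eq | _ = contradiction (sym eq) i≢i′
  ... | no _ | yes _ = refl
  ... | no _ | no ≢ = contradiction refl ≢

  row-other : ∀ a c → a ≢ i → a ≢ i′ → switchedRow a c ≡ at M a c
  row-other a c ≢i ≢i′ with a Fin.≟ i | a Fin.≟ i′
  ... | yes eq | _ = contradiction eq ≢i
  ... | no _ | yes eq = contradiction eq ≢i′
  ... | no _ | no _ = refl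

  col-other : ∀ a c → c ≢ j → c ≢ j′ → switchedRow a c ≡ at M a c
  col-other a c ≢j ≢j′ with a Fin.≟ i | a Fin.≟ i′
  ... | yes refl | _ = twoPoints-other j j′ up₁ down₁ (at M i) c ≢j ≢j′
  ... | no _ | yes refl = twoPoints-other j′ j up₂ down₂ (at M i′) c ≢j′ ≢j
  ... | no _ | no _ = refl

  N : Matrix (suc q) m n
  N = fromEntries switchedRow

  at-N : ∀ a c → at N a c ≡ switchedRow a c
  at-N = at-fromEntries switchedRow

  N-ij : toℕ (at N i j) ≡ suc (toℕ (at M i j))
  N-ij = trans (cong toℕ (trans (at-N i j) (trans (row-i j) (twoPoints-fst j j′ up₁ down₁ (at M i))))) (proj₂ (increment (at M i j) t))

  N-ij′ : toℕ (at M i j′) ≡ suc (toℕ (at N i j′))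
  N-ij′ = trans (proj₂ (decrement (at M i j′) e))
    (cong (suc ∘ toℕ) (sym (trans (at-N i j′) (trans (row-i j′) (twoPoints-snd j j′ up₁ down₁ (at M i) j≢j′)))))

  N-i′j′ : toℕ (at N i′ j′) ≡ suc (toℕ (at M i′ j′))
  N-i′j′ = trans (cong toℕ (trans (at-N i′ j′) (trans (row-i′ j′) (twoPoints-fst j′ j up₂ down₂ (at M i′))))) (proj₂ (increment (at M i′ j′) t′))

  N-i′j : toℕ (at M i′ j) ≡ suc (toℕ (at N i′ j))
  N-i′j = trans (proj₂ (decrement (at M i′ j) e′))
    (cong (suc ∘ toℕ) (sym (trans (at-N i′ j) (trans (row-i′ j) (twoPoints-snd j′ j up₂ down₂ (at M i′) (j≢j′ ∘ sym))))))

  N-row : ∀ a c → a ≢ i → a ≢ i′ → toℕ (at N a c) ≡ toℕ (at M a c)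
  N-row a c ≢i ≢i′ = cong toℕ (trans (at-N a c) (row-other a c ≢i ≢i′))

  N-col : ∀ a c → c ≢ j → c ≢ j′ → toℕ (at N a c) ≡ toℕ (at M a c)
  N-col a c ≢j ≢j′ = cong toℕ (trans (at-N a c) (col-other a c ≢j ≢j′))

  rowSum-N : ∀ a → rowSum N a ≡ rowSum M a
  rowSum-N a with a Fin.≟ i | a Fin.≟ i′
  ... | yes refl | _ = σ-switch j≢j′ N-ij N-ij′ (λ c → N-col a c)
  ... | no _ | yes refl = σ-switch (j≢j′ ∘ sym) N-i′j′ N-i′j (λ c ≢j′ ≢j → N-col a c ≢j ≢j′)
  ... | no ≢i | no ≢i′ = σ-cong λ c → N-row a c ≢i ≢i′

  colSum-N : ∀ c → colSum N c ≡ colSum M c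
  colSum-N c with c Fin.≟ j | c Fin.≟ j′
  ... | yes refl | _ = σ-switch i≢i′ N-ij N-i′j (λ a → N-row a c)
  ... | no _ | yes refl = σ-switch (i≢i′ ∘ sym) N-i′j′ N-ij′ (λ a ≢i′ ≢i → N-row a c ≢i ≢i′)
  ... | no ≢j | no ≢j′ = σ-cong λ a → N-col a c ≢j ≢j′

-- The switched matrix keeps all sums, but its entry at (i, j) is larger by one.
lonesum⇒unswitchable : (M : Matrix (suc q) m n) → IsLonesum M → Unswitchable M
lonesum⇒unswitchable M lonesum i i′ j j′ t e t′ e′ i≢ j≢ =
  ℕ.1+n≢n (trans (sym N-ij) (cong (λ M → toℕ (at M i j)) (lonesum N
    (lookup-ext λ a → trans (lookup-rowSums N a) (trans (rowSum-N a) (sym (lookup-rowSums M a))))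
    (lookup-ext λ c → trans (lookup-colSums N c) (trans (colSum-N c) (sym (lookup-colSums M c)))))))
  where open Switch M t e t′ e′ i≢ j≢

-- By the pigeonhole principle; the gap is written `suc d`, in the form that `never-returns`
-- expects.
repeats : ∀ (f : ℕ → Fin n) → ∃₂ λ a d → f (suc d + a) ≡ f a
repeats {n} f with Fin.pigeonhole (ℕ.n<1+n n) (f ∘ toℕ)
... | x , y , x<y , eq = toℕ x , toℕ y ∸ suc (toℕ x) ,
  trans (cong f (trans (sym (ℕ.+-suc _ (toℕ x))) (ℕ.m∸n+n≡m x<y))) (sym eq)

-- Alternate between entries where N < M and entries where N > M, the next
-- one always in the same column or row. Unswitchability of M shows that this
-- walk never returns to a column that it has left.
module Walk {M N : Matrix (suc (suc p)) m n} (U : Unswitchable M)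
  (rowEq : ∀ i → rowSum N i ≡ rowSum M i) (colEq : ∀ j → colSum N j ≡ colSum M j) where

  Below Above : Fin m → Fin n → Set
  Below i j = toℕ (at N i j) < toℕ (at M i j)
  Above i j = toℕ (at M i j) < toℕ (at N i j)

  State : Set
  State = ∃₂ Below

  column : State → Fin n
  column (_ , j , _) = j

  above-in-column : ∀ {i} j → Below i j → ∃ λ i′ → Above i′ j
  above-in-column {i} j lt = σ-balance (colEq j) i lt

  below-in-row : ∀ i {j} → Above i j → ∃ λ j′ → Below i j′
  below-in-row i {j} gt = σ-balance (sym (rowEq i)) j gt

  step : State → State
  step (_ , j , lt) = let i′ , gt = above-in-column j lt in i′ , below-in-row i′ gt

  -- The first half strengthens the claim so that it can be carried along the walk: a raisable entry
  -- in column `c` of the current row supplies one corner of the next forbidden switch.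
  Avoids : Fin n → State → Set
  Avoids c (i , j , _) = isTop (at M i c) ≡ false × j ≢ c

  -- The new row has `M` below `N` in the starting column, so its entry there is less than q - 1,
  -- and the walk leaves this row through a column where `M` exceeds `N`.
  avoids-start : ∀ s → Avoids (column s) (step s)
  avoids-start (i , j , lt) =
    let i′ , gt = above-in-column j lt
        j′ , lt′ = below-in-row i′ gt
    in <⇒¬isTop gt , λ eq → ℕ.<-asym gt (subst (Below i′) eq lt′)

  -- If row `i′` were positive in column `c`, one could raise (i, c) and (i′, j) and lower (i, j)
  -- and (i′, c). So that entry is 0, which is below q - 1 and cannot exceed an entry of `N`.
  avoids-step : ∀ {c} s → Avoids c s → Avoids c (step s)
  avoids-step {c} (i , j , lt) (e , j≢c) =
    ¬pos⇒¬isTop (at M i′ c) ¬pos , λ eq → true≢false (<⇒pos (subst (Below i′) eq lt′)) ¬pos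
    where
    i′ = proj₁ (above-in-column j lt)
    gt = proj₂ (above-in-column j lt)
    lt′ = proj₂ (below-in-row i′ gt)
    i≢i′ : i ≢ i′
    i≢i′ eq = ℕ.<-asym lt (subst (λ a → Above a j) (sym eq) gt)
    ¬pos : pos (at M i′ c) ≡ false
    ¬pos = ≢true⇒≡false λ t → U i i′ c j e (<⇒pos lt) (<⇒¬isTop gt) t i≢i′ (j≢c ∘ sym)

  walk : ℕ → State → State
  walk zero s = s
  walk (suc k) s = step (walk k s)

  walk-+ : ∀ d k s → walk d (walk k s) ≡ walk (d + k) s
  walk-+ zero k s = refl
  walk-+ (suc d) k s = cong step (walk-+ d k s)

  never-returns : ∀ d s → Avoids (column s) (walk (suc d) s)
  never-returns zero s = avoids-start s
  never-returns (suc d) s = avoids-step (walk (suc d) s) (never-returns d s)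

  -- Any such entry starts an endless walk, whose columns would have to repeat.
  noBelow : ∀ {i j} → ¬ Below i j
  noBelow {i} {j} lt =
    let a , d , eq = repeats (λ k → column (walk k s))
    in proj₂ (never-returns d (walk a s)) (trans (cong column (walk-+ (suc d) a s)) eq)
    where
    s : State
    s = i , j , lt

  equal : N ≡ M
  equal = at-ext λ i j → Fin.toℕ-injective (ℕ.≤-antisym
    (ℕ.≮⇒≥ λ gt → noBelow (proj₂ (below-in-row i {j} gt)))
    (ℕ.≮⇒≥ (noBelow {i} {j})))

unswitchable⇒lonesum : (M : Matrix (suc (suc p)) m n) → Unswitchable M → IsLonesum M
unswitchable⇒lonesum M U N rows cols = Walk.equal U
  (λ i → trans (sym (lookup-rowSums N i)) (trans (cong (λ v → lookup v i) rows) (lookup-rowSums M i)))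
  (λ j → trans (sym (lookup-colSums N j)) (trans (cong (λ v → lookup v j) cols) (lookup-colSums M j)))

listing : ∀ {k} → Card {Matrix (suc (suc p)) m n} Unswitchable k →
  Σ (List (Matrix (suc (suc p)) m n)) λ L →
    Unique L × ((M : Matrix (suc (suc p)) m n) → (M ∈ L) ⇔ IsLonesum M) × (length L ≡ k)
listing (card {L} e length≡) = L , unique e ,
  (λ M → mk⇔ (λ M∈L → unswitchable⇒lonesum M (sound e M∈L))
             (λ lonesum → complete e (lonesum⇒unswitchable M lonesum))) ,
  length≡

theorem3p6 : (q : ℕ) → 2 ≤ q → (m n : ℕ) → 1 ≤ m → 1 ≤ n →
    Σ (List (Matrix q m n)) (λ L →
    Unique L × ((M : Matrix q m n) → (M ∈ L) ⇔ IsLonesum M) × (length L ≡ lonesumCount q m n))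
theorem3p6 (suc (suc p)) (s≤s (s≤s z≤n)) m n _ _ = listing (card-unswitchable p m n)
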